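{- Let $n\ge1$. For every $\sigma\in\mathfrak{S}_{n+1}$, $\psi_{FV}(\sigma)=\psi_{YZL}(\Psi(\sigma))$.
   Context: For $\sigma\in\mathfrak{S}_{n+1}$ define $\psi_{FV}(\sigma)=(s_1\cdots s_n,(p_1,\dots,p_n))$ where, with convention $\sigma(0)=\sigma(n+2)=0$ and peaks/valleys/double ascents/double descents being values $\sigma(i)$ with $\sigma(i-1)<\sigma(i)>\sigma(i+1)$ / $\sigma(i-1)>\sigma(i)<\sigma(i+1)$ / $\sigma(i-1)<\sigma(i)<\sigma(i+1)$ / $\sigma(i-1)>\sigma(i)>\sigma(i+1)$: $s_i=\textsc{U}$ if the value $i$ is a valley, $\textsc{D}$ if a peak, $\textsc{L}_b$ if a double ascent, $\textsc{L}_r$ if a double descent; and $p_i=\#\{j: \sigma^{ -1}(i)<j<n+1,\ \sigma(j)<i<\sigma(j+1)\}$. Define $\psi_{YZL}(\sigma)=(s_1\cdots s_n,(p_1,\dots,p_n))$ by $s_i=\textsc{U}$ if $i<\sigma(i)$ and $i+1\le\sigma^{ -1}(i+1)$; $s_i=\textsc{D}$ if $i\ge\sigma(i)$ and $i+1>\sigma^{ -1}(i+1)$; $s_i=\textsc{L}_b$ if $i<\sigma(i)$ and $i+1>\sigma^{ -1}(i+1)$; $s_i=\textsc{L}_r$ if $i\ge\sigma(i)$ and $i+1\le\sigma^{ -1}(i+1)$; and $p_i=\mathsf{nest}_i\sigma=\#\{j:j<i<\sigma(i)<\sigma(j)\text{ or }\sigma(j)<\sigma(i)\le i<j\}$. The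 map $\Phi:\mathfrak{S}_m\to\mathfrak{S}_m$: for $\rho\in\mathfrak{S}_m$, a letter $\rho(i)$ is a descent top if $i\le m-1$ and $\rho(i)>\rho(i+1)$, a descent bottom if $i\ge2$ and $\rho(i-1)>\rho(i)$; otherwise a nondescent top (resp. bottom). For $x=\rho(i)$ let $c(x)=\#\{j:i<j<m,\ \rho(j+1)<x<\rho(j)\}$. Let $f$ (resp. $g$) be the increasing word of descent bottoms (resp. nondescent bottoms); $f'$ the arrangement of descent tops in which each letter $x$ has exactly $c(x)$ larger letters to its left; $g'$ the arrangement of nondescent tops in which each letter $x$ has exactly $c(x)$ smaller letters to its right. With the two-row array of top row $fg$ and bottom row $f'g'$, $\Phi(\rho)=\tau$ where $\tau(b)=a$ for each column (top $a$, bottom $b$). The map $\Psi:\mathfrak{S}_m\to\mathfrak{S}_m$: $\hat\rho\in\mathfrak{S}_{m+1}$ is $\hat\rho(i)=\rho(i)+1$ ($i\le m$), $\hat\rho(m+1)=1$; $\tau=\Phi(\hat\rho)$ satisfies $\tau(1)=m+1$, and $\Psi(\rho)=\tau(2)\cdots\tau(m+1)$. Here $\Psi$ is applied with $m=n+1$. -}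

module Defs where

open import Data.Bool using (if_then_else_)
open import Data.Empty using (⊥)
open import Data.Fin using (Fin; zero; suc; toℕ; fromℕ; fromℕ<; cast; punchIn)
open import Data.Fin.Permutation as Perm
  using (Permutation′; _⟨$⟩ʳ_; _⟨$⟩ˡ_; flip; _∘ₚ_; insert; remove; cast-id; inverseˡ; inverseʳ)
import Data.Fin.Properties as Fin
open import Data.List using (List; []; _∷_; _++_; _∷ʳ_; length; filter; applyUpTo; zip; lookup; reverse; take; drop; initLast; _∷ʳ′_)
import Data.List.Properties as List
open import Data.List.Membership.Propositional using (_∈_)
open import Data.List.Membership.Propositional.Properties
  using (∈-applyUpTo⁺; ∈-applyUpTo⁻; ∈-filter⁺; ∈-filter⁻; ∈-∃++; ∈-++⁺ˡ; ∈-++⁺ʳ; ∈-++⁻; ∈-insert)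
open import Data.List.Relation.Binary.Permutation.Propositional
  using (_↭_; ↭-refl; ↭-sym; ↭-trans; ↭-prep; ↭-reflexive; ↭⇒↭ₛ)
import Data.List.Relation.Binary.Permutation.Propositional.Properties as Perm↭
open import Data.List.Relation.Binary.Permutation.Homogeneous using (onIndices)
import Data.List.Relation.Binary.Permutation.Setoid.Properties as SetoidPermP
open import Data.List.Relation.Unary.All as All using (All; []; _∷_)
import Data.List.Relation.Unary.All.Properties as AllP
open import Data.List.Relation.Unary.AllPairs as AllPairs using (AllPairs; []; _∷_)
import Data.List.Relation.Unary.AllPairs.Properties as AllPairsP
open import Data.List.Relation.Unary.Any using (here; there)
open import Data.List.Relation.Unary.Unique.Propositional using (Unique)
open import Data.Nat
  using (ℕ; zero; suc; _+_; _∸_; _≤_; _<_; _>_; z≤n; s≤s; _<?_; _≤?_)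
import Data.Nat.Properties as ℕ
open import Data.Product using (_×_; _,_; proj₁; proj₂; ∃; ∃₂)
open import Data.Sum using (_⊎_; inj₁; inj₂)
open import Data.Vec using (Vec; tabulate)
open import Function using (_∘_)
open import Relation.Binary using (Tri; tri<; tri≈; tri>)
open import Relation.Binary.PropositionalEquality
open import Relation.Nullary using (¬_; Dec; yes; no; does; contradiction)
open import Relation.Nullary.Decidable using (_×-dec_; _⊎-dec_; ¬?)
open import Relation.Unary using (Pred; Decidable)
open import Level using (0ℓ)

private
  variable
    m n : ℕ

-- The library's Permutation′ m acts on {0,…,m−1}; σ ⟪ i ⟫ is the same
-- permutation read on {1,…,m}.  Outside this range the value is 0, so that
-- σ ⟪ 0 ⟫ = σ ⟪ m + 1 ⟫ = 0.  The inverse is (flip σ) ⟪ x ⟫.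

infix 25 _⟪_⟫

_⟪_⟫ : Permutation′ m → ℕ → ℕ
σ ⟪ zero ⟫ = 0
_⟪_⟫ {m} σ (suc i) with i <? m
... | yes i<m = suc (toℕ (σ ⟨$⟩ʳ fromℕ< i<m))
... | no  _   = 0

letters : ℕ → List ℕ
letters m = applyUpTo suc m

-- Counts over 1 ≤ j ≤ m.

count : {P : Pred ℕ 0ℓ} → Decidable P → ℕ → ℕ
count P? m = length (filter P? (letters m))

data Step : Set where
  U D L-b L-r : Step

module _ (σ : Permutation′ m) where

  Valley Peak DoubleAscent DoubleDescent : ℕ → Set
  Valley x = let i = flip σ ⟪ x ⟫ in
    σ ⟪ i ∸ 1 ⟫ > σ ⟪ i ⟫ × σ ⟪ i ⟫ < σ ⟪ suc i ⟫
  Peak x = let i = flip σ ⟪ x ⟫ in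
    σ ⟪ i ∸ 1 ⟫ < σ ⟪ i ⟫ × σ ⟪ i ⟫ > σ ⟪ suc i ⟫
  DoubleAscent x = let i = flip σ ⟪ x ⟫ in
    σ ⟪ i ∸ 1 ⟫ < σ ⟪ i ⟫ × σ ⟪ i ⟫ < σ ⟪ suc i ⟫
  DoubleDescent x = let i = flip σ ⟪ x ⟫ in
    σ ⟪ i ∸ 1 ⟫ > σ ⟪ i ⟫ × σ ⟪ i ⟫ > σ ⟪ suc i ⟫

  valley? : Decidable Valley
  valley? x = _ <? _ ×-dec _ <? _

  peak? : Decidable Peak
  peak? x = _ <? _ ×-dec _ <? _

  doubleAscent? : Decidable DoubleAscent
  doubleAscent? x = _ <? _ ×-dec _ <? _

  -- The last branch is the double descents: see kinds-exhaustive.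

  stepFV : ℕ → Step
  stepFV x =
    if does (valley? x)       then U   else
    if does (peak? x)         then D   else
    if does (doubleAscent? x) then L-b else L-r

  weightFV : ℕ → ℕ
  weightFV i = count
    (λ j → flip σ ⟪ i ⟫ <? j ×-dec j <? m ×-dec
           σ ⟪ j ⟫ <? i ×-dec i <? σ ⟪ suc j ⟫) m

  stepYZL : ℕ → Step
  stepYZL i with i <? σ ⟪ i ⟫ | suc i ≤? flip σ ⟪ suc i ⟫
  ... | yes _ | yes _ = U
  ... | no  _ | no  _ = D
  ... | yes _ | no  _ = L-b
  ... | no  _ | yes _ = L-r

  nest : ℕ → ℕ
  nest i = count
    (λ j → (j <? i ×-dec i <? σ ⟪ i ⟫ ×-dec σ ⟪ i ⟫ <? σ ⟪ j ⟫)
           ⊎-dec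
           (σ ⟪ j ⟫ <? σ ⟪ i ⟫ ×-dec σ ⟪ i ⟫ ≤? i ×-dec i <? j)) m

ψFV : Permutation′ (suc n) → Vec Step n × Vec ℕ n
ψFV σ = tabulate (λ i → stepFV σ (suc (toℕ i)))
      , tabulate (λ i → weightFV σ (suc (toℕ i)))

ψYZL : Permutation′ (suc n) → Vec Step n × Vec ℕ n
ψYZL σ = tabulate (λ i → stepYZL σ (suc (toℕ i)))
       , tabulate (λ i → nest σ (suc (toℕ i)))

module _ (ρ : Permutation′ m) where

  DescentTop DescentBottom : ℕ → Set
  DescentTop x = let i = flip ρ ⟪ x ⟫ in
    i < m × ρ ⟪ i ⟫ > ρ ⟪ suc i ⟫
  DescentBottom x = let i = flip ρ ⟪ x ⟫ in
    2 ≤ i × ρ ⟪ i ∸ 1 ⟫ > ρ ⟪ i ⟫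

  descentTop? : Decidable DescentTop
  descentTop? x = _ <? _ ×-dec _ <? _

  descentBottom? : Decidable DescentBottom
  descentBottom? x = 2 ≤? _ ×-dec _ <? _

  -- As sublists of 1,…,m these are all increasing words.

  descentTops nondescentTops descentBottoms nondescentBottoms : List ℕ
  descentTops       = filter descentTop? (letters m)
  nondescentTops    = filter (¬? ∘ descentTop?) (letters m)
  descentBottoms    = filter descentBottom? (letters m)
  nondescentBottoms = filter (¬? ∘ descentBottom?) (letters m)

  crossings : ℕ → ℕ
  crossings x = count
    (λ j → flip ρ ⟪ x ⟫ <? j ×-dec j <? m ×-dec
           ρ ⟪ suc j ⟫ <? x ×-dec x <? ρ ⟪ j ⟫) m

-- w is an arrangement of xs in which every letter x has exactly c x larger
-- letters to its left, respectively c x smaller letters to its right.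

record LargerToLeft (c : ℕ → ℕ) (xs w : List ℕ) : Set where
  field
    arrangement : w ↭ xs
    larger      : ∀ u x v → w ≡ u ++ x ∷ v → length (filter (x <?_) u) ≡ c x

record SmallerToRight (c : ℕ → ℕ) (xs w : List ℕ) : Set where
  field
    arrangement : w ↭ xs
    smaller     : ∀ u x v → w ≡ u ++ x ∷ v → length (filter (_<? x) v) ≡ c x

open LargerToLeft
open SmallerToRight

⟪⟫-toℕ : (σ : Permutation′ m) (i : Fin m) → σ ⟪ suc (toℕ i) ⟫ ≡ suc (toℕ (σ ⟨$⟩ʳ i))
⟪⟫-toℕ {m} σ i with toℕ i <? m
... | yes p = cong (λ k → suc (toℕ (σ ⟨$⟩ʳ k))) (Fin.fromℕ<-toℕ i p)
... | no ¬p = contradiction (Fin.toℕ<n i) ¬p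

toFin : ∀ {x} → 1 ≤ x → x ≤ m → ∃ λ (i : Fin m) → x ≡ suc (toℕ i)
toFin {x = suc x} _ x<m = fromℕ< x<m , cong suc (sym (Fin.toℕ-fromℕ< x<m))

∈letters⁺ : ∀ {x} → 1 ≤ x → x ≤ m → x ∈ letters m
∈letters⁺ {x = suc x} _ x<m = ∈-applyUpTo⁺ suc x<m

∈letters⁻ : ∀ {x} → x ∈ letters m → 1 ≤ x × x ≤ m
∈letters⁻ {m} p with _ , i<m , refl ← ∈-applyUpTo⁻ suc {n = m} p = s≤s z≤n , i<m

letters-∷ʳ : ∀ k → letters (suc k) ≡ letters k ∷ʳ suc k
letters-∷ʳ k = sym (List.applyUpTo-∷ʳ suc k)

letters-last : ∀ {M} → 1 ≤ M → letters M ≡ letters (M ∸ 1) ∷ʳ M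
letters-last {suc m} _ = letters-∷ʳ m

letters-< : ∀ m → AllPairs _<_ (letters m)
letters-< m = AllPairsP.applyUpTo⁺₁ suc m (λ i<j _ → s≤s i<j)

module _ (σ : Permutation′ m) {x : ℕ} (1≤x : 1 ≤ x) (x≤m : x ≤ m) where

  ⟪⟫-pos : 1 ≤ σ ⟪ x ⟫
  ⟪⟫-pos with i , refl ← toFin 1≤x x≤m rewrite ⟪⟫-toℕ σ i = s≤s z≤n

  ⟪⟫-≤ : σ ⟪ x ⟫ ≤ m
  ⟪⟫-≤ with i , refl ← toFin 1≤x x≤m rewrite ⟪⟫-toℕ σ i = Fin.toℕ<n _

  flip-⟪⟫ : flip σ ⟪ σ ⟪ x ⟫ ⟫ ≡ x
  flip-⟪⟫ with i , refl ← toFin 1≤x x≤m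
    rewrite ⟪⟫-toℕ σ i | ⟪⟫-toℕ (flip σ) (σ ⟨$⟩ʳ i) | inverseˡ σ {i} = refl

  ⟪⟫-flip : σ ⟪ flip σ ⟪ x ⟫ ⟫ ≡ x
  ⟪⟫-flip with i , refl ← toFin 1≤x x≤m
    rewrite ⟪⟫-toℕ (flip σ) i | ⟪⟫-toℕ σ (σ ⟨$⟩ˡ i) | inverseʳ σ {i} = refl

⟪⟫-beyond : (σ : Permutation′ m) → σ ⟪ suc m ⟫ ≡ 0
⟪⟫-beyond {m} σ with m <? m
... | yes m<m = contradiction m<m (ℕ.<-irrefl refl)
... | no  _   = refl

⟪⟫-step-≢ : (σ : Permutation′ m) → ∀ {i} → i ≤ m → 1 ≤ m → σ ⟪ i ⟫ ≢ σ ⟪ suc i ⟫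
⟪⟫-step-≢ σ {zero} _ 1≤m eq with () ← subst (1 ≤_) (sym eq) (⟪⟫-pos σ (s≤s z≤n) 1≤m)
⟪⟫-step-≢ {m} σ {suc i} i<m _ eq with ℕ.m≤n⇒m<n∨m≡n i<m
... | inj₂ refl with () ← subst (1 ≤_) (trans eq (⟪⟫-beyond σ)) (⟪⟫-pos σ (s≤s z≤n) ℕ.≤-refl)
... | inj₁ si<m = ℕ.<⇒≢ (ℕ.n<1+n (suc i)) (begin
  suc i                           ≡⟨ flip-⟪⟫ σ (s≤s z≤n) i<m ⟨
  flip σ ⟪ σ ⟪ suc i ⟫ ⟫          ≡⟨ cong (flip σ ⟪_⟫) eq ⟩
  flip σ ⟪ σ ⟪ suc (suc i) ⟫ ⟫    ≡⟨ flip-⟪⟫ σ (s≤s z≤n) si<m ⟩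
  suc (suc i)                     ∎)
  where open ≡-Reasoning

kinds-exhaustive : (σ : Permutation′ m) → ∀ {x} → 1 ≤ x → x ≤ m →
  Valley σ x ⊎ Peak σ x ⊎ DoubleAscent σ x ⊎ DoubleDescent σ x
kinds-exhaustive {m} σ {x} 1≤x x≤m
  with flip σ ⟪ x ⟫ | ⟪⟫-pos (flip σ) 1≤x x≤m | ⟪⟫-≤ (flip σ) 1≤x x≤m
... | suc i | _ | i<m
  with ℕ.<-cmp (σ ⟪ i ⟫) (σ ⟪ suc i ⟫) | ℕ.<-cmp (σ ⟪ suc i ⟫) (σ ⟪ suc (suc i) ⟫)
... | tri≈ _ e _ | _ = contradiction e (⟪⟫-step-≢ σ (ℕ.<⇒≤ i<m) (ℕ.≤-trans 1≤x x≤m))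
... | _ | tri≈ _ e _ = contradiction e (⟪⟫-step-≢ σ i<m (ℕ.≤-trans 1≤x x≤m))
... | tri> _ _ a | tri< b _ _ = inj₁ (a , b)
... | tri< a _ _ | tri> _ _ b = inj₂ (inj₁ (a , b))
... | tri< a _ _ | tri< b _ _ = inj₂ (inj₂ (inj₁ (a , b)))
... | tri> _ _ a | tri> _ _ b = inj₂ (inj₂ (inj₂ (a , b)))

pigeonhole : (f g : ℕ → ℕ) {xs ys : List ℕ} → Unique xs →
  (∀ {x} → x ∈ xs → g (f x) ≡ x) → (∀ {x} → x ∈ xs → f x ∈ ys) →
  length xs ≤ length ys
pigeonhole f g {[]} _ _ _ = z≤n
pigeonhole f g {x ∷ xs} (x∉ ∷ xs!) gf sub
  with ys₁ , ys₂ , refl ← ∈-∃++ (sub (here refl)) =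
  subst (suc (length xs) ≤_) (sym (Perm↭.↭-length (Perm↭.shift (f x) ys₁ ys₂)))
    (s≤s (pigeonhole f g xs! (gf ∘ there) sub′))
  where
  sub′ : ∀ {y} → y ∈ xs → f y ∈ ys₁ ++ ys₂
  sub′ {y} y∈ with ∈-++⁻ ys₁ (sub (there y∈))
  ... | inj₁ p = ∈-++⁺ˡ p
  ... | inj₂ (there p) = ∈-++⁺ʳ ys₁ p
  ... | inj₂ (here e) = contradiction
    (trans (sym (gf (here refl))) (trans (cong g (sym e)) (gf (there y∈))))
    (All.lookup x∉ y∈)

filter-++-filter : {P : Pred ℕ 0ℓ} (P? : Decidable P) (xs : List ℕ) →
  filter P? xs ++ filter (¬? ∘ P?) xs ↭ xs
filter-++-filter P? [] = ↭-refl
filter-++-filter P? (x ∷ xs) with P? x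
... | yes p = ↭-prep x (filter-++-filter P? xs)
... | no ¬p = ↭-trans (Perm↭.shift x (filter P? xs) _) (↭-prep x (filter-++-filter P? xs))

∈⇒length≢0 : ∀ {x : ℕ} {xs} → x ∈ xs → length xs ≢ 0
∈⇒length≢0 (here _)  ()
∈⇒length≢0 (there _) ()

-- The two ways an occurrence of y splits a concatenation.

++-split : ∀ (a b u : List ℕ) {y v} → a ++ b ≡ u ++ y ∷ v →
  (∃ λ w → a ≡ u ++ y ∷ w × v ≡ w ++ b) ⊎
  (∃ λ w → u ≡ a ++ w × b ≡ w ++ y ∷ v)
++-split [] b u eq = inj₂ (u , refl , eq)
++-split (x ∷ a) b [] refl = inj₁ (a , refl , refl)
++-split (x ∷ a) b (z ∷ u) eq with List.∷-injective eq
... | refl , eq′ with ++-split a b u eq′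
...   | inj₁ (w , refl , e) = inj₁ (w , refl , e)
...   | inj₂ (w , refl , e) = inj₂ (w , refl , e)

count-suc : {P : Pred ℕ 0ℓ} (P? : Decidable P) (k : ℕ) →
  (P (suc k) × count P? (suc k) ≡ suc (count P? k)) ⊎
  (¬ P (suc k) × count P? (suc k) ≡ count P? k)
count-suc P? k with P? (suc k)
... | yes p = inj₁ (p , (begin
  length (filter P? (letters (suc k)))                  ≡⟨ cong (length ∘ filter P?) (letters-∷ʳ k) ⟩
  length (filter P? (letters k ∷ʳ suc k))               ≡⟨ cong length (List.filter-++ P? (letters k) _) ⟩
  length (filter P? (letters k) ++ filter P? (suc k ∷ [])) ≡⟨ List.length-++ (filter P? (letters k)) ⟩
  count P? k + length (filter P? (suc k ∷ []))          ≡⟨ cong (λ l → count P? k + length l) (List.filter-accept P? p) ⟩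
  count P? k + 1                                        ≡⟨ ℕ.+-comm _ 1 ⟩
  suc (count P? k)                                      ∎))
  where open ≡-Reasoning
... | no ¬p = inj₂ (¬p , (begin
  length (filter P? (letters (suc k)))                  ≡⟨ cong (length ∘ filter P?) (letters-∷ʳ k) ⟩
  length (filter P? (letters k ∷ʳ suc k))               ≡⟨ cong length (List.filter-++ P? (letters k) _) ⟩
  length (filter P? (letters k) ++ filter P? (suc k ∷ [])) ≡⟨ List.length-++ (filter P? (letters k)) ⟩
  count P? k + length (filter P? (suc k ∷ []))          ≡⟨ cong (λ l → count P? k + length l) (List.filter-reject P? ¬p) ⟩
  count P? k + 0                                        ≡⟨ ℕ.+-identityʳ _ ⟩
  count P? k                                            ∎))
  where open ≡-Reasoning

module Arrange (R : ℕ → ℕ → Set) (R? : ∀ x y → Dec (R x y))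
               (asym : ∀ {x y} → R x y → ¬ R y x) (c : ℕ → ℕ) where

  Spec : List ℕ → Set
  Spec w = ∀ u x v → w ≡ u ++ x ∷ v → length (filter (R? x) u) ≡ c x

  private
    length-filter-skip : ∀ {x y} a b → ¬ R y x →
      length (filter (R? y) (a ++ x ∷ b)) ≡ length (filter (R? y) (a ++ b))
    length-filter-skip {x} {y} a b ¬r = cong length (begin
      filter (R? y) (a ++ x ∷ b)                 ≡⟨ List.filter-++ (R? y) a _ ⟩
      filter (R? y) a ++ filter (R? y) (x ∷ b)   ≡⟨ cong (filter (R? y) a ++_) (List.filter-reject (R? y) ¬r) ⟩
      filter (R? y) a ++ filter (R? y) b         ≡⟨ List.filter-++ (R? y) a b ⟨
      filter (R? y) (a ++ b)                     ∎)
      where open ≡-Reasoning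

    spec-insert : ∀ {x} a b → All (R x) (a ++ b) → length a ≡ c x →
      Spec (a ++ b) → Spec (a ++ x ∷ b)
    spec-insert {x} a b all len spec u y v eq with ++-split a (x ∷ b) u eq
    ... | inj₁ (w , refl , _) = spec u y (w ++ b) (List.++-assoc u (y ∷ w) b)
    ... | inj₂ ([] , e , refl) rewrite trans e (List.++-identityʳ a) =
      trans (cong length (List.filter-all (R? x) (AllP.++⁻ˡ a all))) len
    ... | inj₂ (x ∷ w , refl , refl) =
      trans (length-filter-skip a w (asym (All.lookup all (∈-++⁺ʳ a (∈-insert w)))))
            (spec (a ++ w) y v (sym (List.++-assoc a w (y ∷ v))))

    spec-remove : ∀ {x} a b → All (R x) (a ++ b) → Spec (a ++ x ∷ b) → Spec (a ++ b)
    spec-remove {x} a b all spec u y v eq with ++-split a b u eq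
    ... | inj₁ (w , refl , refl) = spec u y (w ++ x ∷ b) (List.++-assoc u (y ∷ w) (x ∷ b))
    ... | inj₂ (w , refl , refl) =
      trans (sym (length-filter-skip a w (asym (All.lookup all (∈-++⁺ʳ a (∈-insert w))))))
            (spec (a ++ x ∷ w) y v (sym (List.++-assoc a (x ∷ w) (y ∷ v))))

  arrange : ∀ {xs} → AllPairs R xs →
    (∀ {x} → x ∈ xs → c x ≤ length (filter (R? x) xs)) →
    ∃ λ w → w ↭ xs × Spec w
  arrange [] _ = [] , ↭-refl , λ { [] _ _ () ; (_ ∷ _) _ _ () }
  arrange {x ∷ xs} (x<xs ∷ ap) bound = a ++ x ∷ b , perm , spec′
    where
    skip : ∀ {y} → y ∈ x ∷ xs → ¬ R y x → c y ≤ length (filter (R? y) xs)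
    skip {y} y∈ ¬r = subst (λ l → c y ≤ length l) (List.filter-reject (R? y) ¬r) (bound y∈)
    ih = arrange ap (λ y∈ → skip (there y∈) (asym (All.lookup x<xs y∈)))
    w  = proj₁ ih
    a  = take (c x) w
    b  = drop (c x) w
    ab≡w : a ++ b ≡ w
    ab≡w = List.take++drop≡id (c x) w
    perm : a ++ x ∷ b ↭ x ∷ xs
    perm = ↭-trans (Perm↭.shift x a b)
             (↭-prep x (↭-trans (↭-reflexive ab≡w) (proj₁ (proj₂ ih))))
    cx≤ : c x ≤ length w
    cx≤ = subst (c x ≤_)
      (trans (cong length (List.filter-all (R? x) x<xs)) (sym (Perm↭.↭-length (proj₁ (proj₂ ih)))))
      (skip (here refl) (λ r → asym r r))
    spec′ : Spec (a ++ x ∷ b)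
    spec′ = spec-insert a b
      (subst (All (R x)) (sym ab≡w) (Perm↭.All-resp-↭ (↭-sym (proj₁ (proj₂ ih))) x<xs))
      (trans (List.length-take (c x) w) (ℕ.m≤n⇒m⊓n≡m cx≤))
      (subst Spec (sym ab≡w) (proj₂ (proj₂ ih)))

  arrange-unique : ∀ {xs w w′} → AllPairs R xs →
    w ↭ xs → Spec w → w′ ↭ xs → Spec w′ → w ≡ w′
  arrange-unique [] p _ p′ _ = trans (Perm↭.↭-empty-inv p) (sym (Perm↭.↭-empty-inv p′))
  arrange-unique {x ∷ xs} (x<xs ∷ ap) p s p′ s′
    with a  , b  , refl ← ∈-∃++ (Perm↭.∈-resp-↭ (↭-sym p) (here refl))
    with a′ , b′ , refl ← ∈-∃++ (Perm↭.∈-resp-↭ (↭-sym p′) (here refl)) =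
    cong₂ (λ u v → u ++ x ∷ v) a≡a′ (List.++-cancelˡ a b b′ (trans ab≡ (cong (_++ b′) (sym a≡a′))))
    where
    q  : a ++ b ↭ xs
    q  = Perm↭.drop-mid a [] p
    q′ : a′ ++ b′ ↭ xs
    q′ = Perm↭.drop-mid a′ [] p′
    all  = Perm↭.All-resp-↭ (↭-sym q) x<xs
    all′ = Perm↭.All-resp-↭ (↭-sym q′) x<xs
    ab≡ : a ++ b ≡ a′ ++ b′
    ab≡ = arrange-unique ap q (spec-remove a b all s) q′ (spec-remove a′ b′ all′ s′)
    len : length a ≡ length a′
    len = begin
      length a                   ≡⟨ cong length (List.filter-all (R? x) (AllP.++⁻ˡ a all)) ⟨
      length (filter (R? x) a)   ≡⟨ s a x b refl ⟩
      c x                        ≡⟨ s′ a′ x b′ refl ⟨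
      length (filter (R? x) a′)  ≡⟨ cong length (List.filter-all (R? x) (AllP.++⁻ˡ a′ all′)) ⟩
      length a′                  ∎
      where open ≡-Reasoning
    same : ∀ (a a′ : List ℕ) → a ++ b ≡ a′ ++ b′ → length a ≡ length a′ → a ≡ a′
    same [] [] _ _ = refl
    same (_ ∷ a) (_ ∷ a′) e l with refl , e′ ← List.∷-injective e =
      cong (_ ∷_) (same a a′ e′ (ℕ.suc-injective l))
    a≡a′ : a ≡ a′
    a≡a′ = same a a′ ab≡ len

module _ {c : ℕ → ℕ} {xs : List ℕ} (inc : AllPairs _<_ xs) where

  private
    module L = Arrange _<_ _<?_ ℕ.<-asym c
    module G = Arrange _>_ (λ x y → y <? x) ℕ.<-asym c

    length-filter-reverse : ∀ {P : Pred ℕ 0ℓ} (P? : Decidable P) ys →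
      length (filter P? (reverse ys)) ≡ length (filter P? ys)
    length-filter-reverse P? ys = Perm↭.↭-length (Perm↭.filter-↭ P? (Perm↭.↭-reverse ys))

    reverse-split : ∀ {w} u (x : ℕ) v → reverse w ≡ u ++ x ∷ v → w ≡ reverse v ++ x ∷ reverse u
    reverse-split {w} u x v eq = begin
      w                             ≡⟨ List.reverse-involutive w ⟨
      reverse (reverse w)           ≡⟨ cong reverse eq ⟩
      reverse (u ++ x ∷ v)          ≡⟨ List.reverse-++ u (x ∷ v) ⟩
      reverse (x ∷ v) ++ reverse u  ≡⟨ cong (_++ reverse u) (List.unfold-reverse x v) ⟩
      (reverse v ∷ʳ x) ++ reverse u ≡⟨ List.++-assoc (reverse v) (x ∷ []) (reverse u) ⟩
      reverse v ++ x ∷ reverse u    ∎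
      where open ≡-Reasoning

    reverse-AllPairs : ∀ {ys} → AllPairs _<_ ys → AllPairs _>_ (reverse ys)
    reverse-AllPairs [] = []
    reverse-AllPairs {y ∷ ys} (p ∷ ps) rewrite List.unfold-reverse y ys =
      AllPairsP.++⁺ (reverse-AllPairs ps) ([] ∷ [])
        (All.map (_∷ []) (Perm↭.All-resp-↭ (↭-sym (Perm↭.↭-reverse ys)) p))

  largerToLeft-exists :
    (∀ {x} → x ∈ xs → c x ≤ length (filter (x <?_) xs)) → ∃ (LargerToLeft c xs)
  largerToLeft-exists bound with w , p , s ← L.arrange inc bound =
    w , record { arrangement = p ; larger = s }

  largerToLeft-unique : ∀ {w w′} → LargerToLeft c xs w → LargerToLeft c xs w′ → w ≡ w′
  largerToLeft-unique a a′ =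
    L.arrange-unique inc (arrangement a) (larger a) (arrangement a′) (larger a′)

  smallerToRight-exists :
    (∀ {x} → x ∈ xs → c x ≤ length (filter (_<? x) xs)) → ∃ (SmallerToRight c xs)
  smallerToRight-exists bound
    with w , p , s ← G.arrange (reverse-AllPairs inc)
           (λ {x} x∈ → subst (c x ≤_) (sym (length-filter-reverse (_<? x) xs))
             (bound (Perm↭.∈-resp-↭ (Perm↭.↭-reverse xs) x∈))) =
    reverse w , record
      { arrangement = ↭-trans (Perm↭.↭-reverse w) (↭-trans p (Perm↭.↭-reverse xs))
      ; smaller = λ u x v eq → trans (sym (length-filter-reverse (_<? x) v))
                                     (s (reverse v) x (reverse u) (reverse-split u x v eq))
      }

  smallerToRight-unique : ∀ {w w′} → SmallerToRight c xs w → SmallerToRight c xs w′ → w ≡ w′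
  smallerToRight-unique {w} {w′} a a′ = List.reverse-injective
    (G.arrange-unique (reverse-AllPairs inc) (perm a) (spec a) (perm a′) (spec a′))
    where
    perm : ∀ {w} → SmallerToRight c xs w → reverse w ↭ reverse xs
    perm {w} a = ↭-trans (Perm↭.↭-reverse w) (↭-trans (arrangement a) (↭-sym (Perm↭.↭-reverse xs)))
    spec : ∀ {w} → SmallerToRight c xs w → G.Spec (reverse w)
    spec a u x v eq = trans (sym (length-filter-reverse (_<? x) u))
                            (smaller a (reverse v) x (reverse u) (reverse-split u x v eq))

module _ (ρ : Permutation′ m) where

  private
    pos : ∀ {x} → x ∈ letters m → 1 ≤ flip ρ ⟪ x ⟫ × flip ρ ⟪ x ⟫ ≤ m
    pos x∈ = let 1≤x , x≤m = ∈letters⁻ x∈ in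
      ⟪⟫-pos (flip ρ) 1≤x x≤m , ⟪⟫-≤ (flip ρ) 1≤x x≤m

  crossings-≤-larger : ∀ {x} →
    crossings ρ x ≤ length (filter (x <?_) (descentTops ρ))
  crossings-≤-larger {x} = pigeonhole (ρ ⟪_⟫) (flip ρ ⟪_⟫)
    (AllPairs.map ℕ.<⇒≢ (AllPairsP.filter⁺ P? (letters-< m)))
    (λ j∈ → let 1≤j , j≤m = ∈letters⁻ (proj₁ (∈-filter⁻ P? j∈)) in flip-⟪⟫ ρ 1≤j j≤m)
    into
    where
    P? = λ j → flip ρ ⟪ x ⟫ <? j ×-dec j <? m ×-dec ρ ⟪ suc j ⟫ <? x ×-dec x <? ρ ⟪ j ⟫
    into : ∀ {j} → j ∈ filter P? (letters m) → ρ ⟪ j ⟫ ∈ filter (x <?_) (descentTops ρ)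
    into {j} j∈ with j∈l , _ , j<m , a , b ← ∈-filter⁻ P? j∈ =
      let 1≤j , j≤m = ∈letters⁻ j∈l in
      ∈-filter⁺ (x <?_)
        (∈-filter⁺ (descentTop? ρ) (∈letters⁺ (⟪⟫-pos ρ 1≤j j≤m) (⟪⟫-≤ ρ 1≤j j≤m))
          (subst (λ i → i < m × ρ ⟪ i ⟫ > ρ ⟪ suc i ⟫) (sym (flip-⟪⟫ ρ 1≤j j≤m))
            (j<m , ℕ.<-trans a b)))
        b

  -- After position i, where ρ(i) = x is a nondescent top, the word steps up
  -- across x or ends below x at least as often as it steps down across x.

  crossings-≤-smaller : ∀ {x} → x ∈ nondescentTops ρ →
    crossings ρ x ≤ length (filter (_<? x) (nondescentTops ρ))
  crossings-≤-smaller {x} x∈ = ℕ.≤-trans final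
    (pigeonhole (ρ ⟪_⟫) (flip ρ ⟪_⟫)
      (AllPairs.map ℕ.<⇒≢ (AllPairsP.filter⁺ N? (letters-< m)))
      (λ j∈ → let 1≤j , j≤m = ∈letters⁻ (proj₁ (∈-filter⁻ N? j∈)) in flip-⟪⟫ ρ 1≤j j≤m)
      into)
    where
    i = flip ρ ⟪ x ⟫
    x∈l = proj₁ (∈-filter⁻ (¬? ∘ descentTop? ρ) {xs = letters m} x∈)
    nd : ¬ (i < m × ρ ⟪ i ⟫ > ρ ⟪ suc i ⟫)
    nd = proj₂ (∈-filter⁻ (¬? ∘ descentTop? ρ) {xs = letters m} x∈)
    ρi≡x : ρ ⟪ i ⟫ ≡ x
    ρi≡x = let 1≤x , x≤m = ∈letters⁻ x∈l in ⟪⟫-flip ρ 1≤x x≤m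
    i≤m = proj₂ (pos x∈l)

    NonTopAt : ℕ → Set
    NonTopAt j = ¬ (j < m × ρ ⟪ j ⟫ > ρ ⟪ suc j ⟫)
    nonTopAt? : Decidable NonTopAt
    nonTopAt? j = ¬? (j <? m ×-dec ρ ⟪ suc j ⟫ <? ρ ⟪ j ⟫)
    C? = λ j → i <? j ×-dec j <? m ×-dec ρ ⟪ suc j ⟫ <? x ×-dec x <? ρ ⟪ j ⟫
    N? = λ j → ρ ⟪ j ⟫ <? x ×-dec nonTopAt? j

    into : ∀ {j} → j ∈ filter N? (letters m) → ρ ⟪ j ⟫ ∈ filter (_<? x) (nondescentTops ρ)
    into {j} j∈ with j∈l , b , nt ← ∈-filter⁻ N? j∈ =
      let 1≤j , j≤m = ∈letters⁻ j∈l in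
      ∈-filter⁺ (_<? x)
        (∈-filter⁺ (¬? ∘ descentTop? ρ) (∈letters⁺ (⟪⟫-pos ρ 1≤j j≤m) (⟪⟫-≤ ρ 1≤j j≤m))
          (subst NonTopAt (sym (flip-⟪⟫ ρ 1≤j j≤m)) nt))
        b

    -- Counts over positions ≤ k, depending on the side of x on which the letter
    -- at position k + 1 lies.

    Inv : ℕ → Set
    Inv k = count C? k ≤ suc (count N? k) × (x ≤ ρ ⟪ suc k ⟫ → count C? k ≤ count N? k)

    C-none : ∀ k → k ≤ i → count C? k ≡ 0
    C-none zero _ = refl
    C-none (suc k) k<i with count-suc C? k
    ... | inj₁ ((i<sk , _) , _) = contradiction k<i (ℕ.<⇒≱ i<sk)
    ... | inj₂ (_ , e) = trans e (C-none k (ℕ.<⇒≤ k<i))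

    N-mono : ∀ k → count N? k ≤ count N? (suc k)
    N-mono k with count-suc N? k
    ... | inj₁ (_ , e) = subst (count N? k ≤_) (sym e) (ℕ.n≤1+n _)
    ... | inj₂ (_ , e) = ℕ.≤-reflexive (sym e)

    start : Inv i
    start rewrite C-none i ℕ.≤-refl = z≤n , λ _ → z≤n

    step : ∀ k → i ≤ k → suc k < m → Inv k → Inv (suc k)
    step k i≤k sk<m (h , h′) with count-suc C? k
    ... | inj₁ ((_ , _ , a , b) , e) rewrite e =
      s≤s (ℕ.≤-trans (h′ (ℕ.<⇒≤ b)) (N-mono k)) , λ x≤ → contradiction x≤ (ℕ.<⇒≱ a)
    ... | inj₂ (¬c , e) rewrite e = ℕ.≤-trans h (s≤s (N-mono k)) , up
      where
      up : x ≤ ρ ⟪ suc (suc k) ⟫ → count C? k ≤ count N? (suc k)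
      up x≤ with x ≤? ρ ⟪ suc k ⟫
      ... | yes p = ℕ.≤-trans (h′ p) (N-mono k)
      ... | no ¬p with count-suc N? k
      ...   | inj₁ (_ , e′) rewrite e′ = h
      ...   | inj₂ (¬n , _) = contradiction
        (ℕ.≰⇒> ¬p , λ (_ , d) → ¬p (ℕ.≤-trans x≤ (ℕ.<⇒≤ d))) ¬n

    inv : ∀ d k → i + d ≡ k → k < m → Inv k
    inv zero k refl _ rewrite ℕ.+-identityʳ i = start
    inv (suc d) k refl k<m rewrite ℕ.+-suc i d =
      step (i + d) (ℕ.m≤m+n i d) k<m (inv d (i + d) refl (ℕ.<⇒≤ k<m))

    last : ∀ k → suc k ≡ m → Inv k → count C? m ≤ count N? m
    last k refl (h , h′) with count-suc C? k
    ... | inj₁ ((_ , sk<m , _) , _) = contradiction sk<m (ℕ.<-irrefl refl)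
    ... | inj₂ (_ , e) rewrite e with x ≤? ρ ⟪ suc k ⟫
    ...   | yes p = ℕ.≤-trans (h′ p) (N-mono k)
    ...   | no ¬p with count-suc N? k
    ...     | inj₁ (_ , e′) rewrite e′ = h
    ...     | inj₂ (¬n , _) = contradiction (ℕ.≰⇒> ¬p , λ (sk<m , _) → ℕ.<-irrefl refl sk<m) ¬n

    final : count C? m ≤ count N? m
    final with ℕ.m≤n⇒m<n∨m≡n i≤m
    ... | inj₂ i≡m rewrite C-none m (ℕ.≤-reflexive (sym i≡m)) = z≤n
    ... | inj₁ i<m = last′ m refl i<m
      where
      last′ : ∀ k → k ≡ m → i < k → count C? m ≤ count N? m
      last′ (suc k) refl (s≤s i≤k) =
        last k refl (inv (k ∸ i) k (ℕ.m+[n∸m]≡n i≤k) ℕ.≤-refl)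

-- A word containing each of 1,…,m once, as a permutation.

fromWord : {w : List ℕ} → w ↭ letters m → Permutation′ m
fromWord {m} {w} p =
  cast-id (trans (sym (List.length-applyUpTo suc m)) (sym (Perm↭.↭-length p)))
  ∘ₚ onIndices (↭⇒↭ₛ p)
  ∘ₚ cast-id (List.length-applyUpTo suc m)

fromWord-lookup : {w : List ℕ} (p : w ↭ letters m) (k : Fin m) .(e : m ≡ length w) →
  suc (toℕ (fromWord p ⟨$⟩ʳ k)) ≡ lookup w (cast e k)
fromWord-lookup {m} {w} p k e = begin
  suc (toℕ (cast _ l))    ≡⟨ cong suc (Fin.toℕ-cast _ l) ⟩
  suc (toℕ l)             ≡⟨ List.lookup-applyUpTo suc m l ⟨
  lookup (letters m) l    ≡⟨ SetoidPermP.onIndices-lookup (setoid ℕ) (↭⇒↭ₛ p) (cast e k) ⟨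
  lookup w (cast e k)     ∎
  where
  open ≡-Reasoning
  l = onIndices (↭⇒↭ₛ p) ⟨$⟩ʳ cast e k

zip-lookup : ∀ {a b} (xs ys : List ℕ) → (a , b) ∈ zip xs ys →
  ∃₂ λ (k : Fin (length xs)) (l : Fin (length ys)) →
    toℕ k ≡ toℕ l × lookup xs k ≡ a × lookup ys l ≡ b
zip-lookup (x ∷ xs) (y ∷ ys) (here refl) = zero , zero , refl , refl , refl
zip-lookup (x ∷ xs) (y ∷ ys) (there p) with k , l , e , p , q ← zip-lookup xs ys p =
  suc k , suc l , cong suc e , p , q

column : {v w : List ℕ} (p : v ↭ letters m) (q : w ↭ letters m) → ∀ {a b} →
  (a , b) ∈ zip v w → (flip (fromWord q) ∘ₚ fromWord p) ⟪ b ⟫ ≡ a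
column {m} {v} {w} p q ab∈ with k , l , k≡l , refl , refl ← zip-lookup v w ab∈ = begin
  π ⟪ lookup w l ⟫                             ≡⟨ cong (λ l → π ⟪ lookup w l ⟫) l≡ ⟩
  π ⟪ lookup w (cast (sym |w|) j) ⟫            ≡⟨ cong (π ⟪_⟫) (fromWord-lookup q j (sym |w|)) ⟨
  π ⟪ suc (toℕ (fromWord q ⟨$⟩ʳ j)) ⟫          ≡⟨ ⟪⟫-toℕ π (fromWord q ⟨$⟩ʳ j) ⟩
  suc (toℕ (π ⟨$⟩ʳ (fromWord q ⟨$⟩ʳ j)))       ≡⟨ cong (λ j → suc (toℕ (fromWord p ⟨$⟩ʳ j))) (inverseˡ (fromWord q)) ⟩
  suc (toℕ (fromWord p ⟨$⟩ʳ j))                ≡⟨ fromWord-lookup p j (sym |v|) ⟩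
  lookup v (cast (sym |v|) j)                  ≡⟨ cong (lookup v) k≡ ⟨
  lookup v k                                   ∎
  where
  open ≡-Reasoning
  π = flip (fromWord q) ∘ₚ fromWord p
  |v| : length v ≡ m
  |v| = trans (Perm↭.↭-length p) (List.length-applyUpTo suc m)
  |w| : length w ≡ m
  |w| = trans (Perm↭.↭-length q) (List.length-applyUpTo suc m)
  j : Fin m
  j = cast |v| k
  toℕ-j : toℕ j ≡ toℕ k
  toℕ-j = Fin.toℕ-cast |v| k
  k≡ : k ≡ cast (sym |v|) j
  k≡ = Fin.toℕ-injective (trans (sym toℕ-j) (sym (Fin.toℕ-cast (sym |v|) j)))
  l≡ : l ≡ cast (sym |w|) j
  l≡ = Fin.toℕ-injective (trans (sym k≡l) (trans (sym toℕ-j) (sym (Fin.toℕ-cast (sym |w|) j))))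

module _ (ρ : Permutation′ m) where

  private
    f′-exists : ∃ (LargerToLeft (crossings ρ) (descentTops ρ))
    f′-exists = largerToLeft-exists
      (AllPairsP.filter⁺ (descentTop? ρ) (letters-< m)) (λ _ → crossings-≤-larger ρ)

    g′-exists : ∃ (SmallerToRight (crossings ρ) (nondescentTops ρ))
    g′-exists = smallerToRight-exists
      (AllPairsP.filter⁺ (¬? ∘ descentTop? ρ) (letters-< m)) (crossings-≤-smaller ρ)

  f g f′ g′ : List ℕ
  f  = descentBottoms ρ
  g  = nondescentBottoms ρ
  f′ = proj₁ f′-exists
  g′ = proj₁ g′-exists

  f′-arranged : LargerToLeft (crossings ρ) (descentTops ρ) f′
  f′-arranged = proj₂ f′-exists

  g′-arranged : SmallerToRight (crossings ρ) (nondescentTops ρ) g′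
  g′-arranged = proj₂ g′-exists

  f′-unique : ∀ {w} → LargerToLeft (crossings ρ) (descentTops ρ) w → w ≡ f′
  f′-unique a = largerToLeft-unique
    (AllPairsP.filter⁺ (descentTop? ρ) (letters-< m)) a f′-arranged

  g′-unique : ∀ {w} → SmallerToRight (crossings ρ) (nondescentTops ρ) w → w ≡ g′
  g′-unique a = smallerToRight-unique
    (AllPairsP.filter⁺ (¬? ∘ descentTop? ρ) (letters-< m)) a g′-arranged

  top-↭ : f ++ g ↭ letters m
  top-↭ = filter-++-filter (descentBottom? ρ) (letters m)

  bottom-↭ : f′ ++ g′ ↭ letters m
  bottom-↭ = ↭-trans (Perm↭.++⁺ (arrangement f′-arranged) (arrangement g′-arranged))
                     (filter-++-filter (descentTop? ρ) (letters m))

  -- The composite sends a bottom letter to its column and then to the top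
  -- letter of that column: see Φ-column.

  Φ : Permutation′ m
  Φ = flip (fromWord bottom-↭) ∘ₚ fromWord top-↭

  Φ-column : ∀ {a b} → (a , b) ∈ zip (f ++ g) (f′ ++ g′) → Φ ⟪ b ⟫ ≡ a
  Φ-column = column top-↭ bottom-↭

-- A permutation whose word ends with 1 is sent to one whose word starts with
-- the largest letter.

module _ {M : ℕ} (1≤M : 1 ≤ M) (ρ : Permutation′ M) (ends : ρ ⟪ M ⟫ ≡ 1) where

  private
    last-zip : ∀ {a b : ℕ} xs ys → length (xs ∷ʳ a) ≡ length (ys ∷ʳ b) →
      (a , b) ∈ zip (xs ∷ʳ a) (ys ∷ʳ b)
    last-zip [] [] _ = here refl
    last-zip [] (_ ∷ []) ()
    last-zip [] (_ ∷ _ ∷ _) ()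
    last-zip (_ ∷ []) [] ()
    last-zip (_ ∷ _ ∷ _) [] ()
    last-zip (_ ∷ xs) (_ ∷ ys) e = there (last-zip xs ys (ℕ.suc-injective e))

    g-last : ∃ λ v → g ρ ≡ v ∷ʳ M
    g-last = filter P? (letters (M ∸ 1)) , (begin
      filter P? (letters M)                       ≡⟨ cong (filter P?) (letters-last 1≤M) ⟩
      filter P? (letters (M ∸ 1) ∷ʳ M)                  ≡⟨ List.filter-++ P? (letters (M ∸ 1)) _ ⟩
      filter P? (letters (M ∸ 1)) ++ filter P? (M ∷ []) ≡⟨ cong (filter P? (letters (M ∸ 1)) ++_) (List.filter-accept P? notBottom) ⟩
      filter P? (letters (M ∸ 1)) ∷ʳ M                  ∎)
      where
      open ≡-Reasoning
      P? = ¬? ∘ descentBottom? ρ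
      i  = flip ρ ⟪ M ⟫
      notBottom : ¬ DescentBottom ρ M
      notBottom (2≤i , d) = ℕ.<⇒≱
        (subst (_< ρ ⟪ i ∸ 1 ⟫) (⟪⟫-flip ρ 1≤M ℕ.≤-refl) d)
        (⟪⟫-≤ ρ (ℕ.∸-monoˡ-≤ 1 2≤i)
          (ℕ.≤-trans (ℕ.m∸n≤m i 1) (⟪⟫-≤ (flip ρ) 1≤M ℕ.≤-refl)))

    -- A letter z > 1 that is a nondescent top is stepped down across later on,
    -- since the word ends with 1.

    crosses : ∀ {z} → z ∈ nondescentTops ρ → z ≢ 1 → crossings ρ z ≢ 0
    crosses {z} z∈ z≢1 c≡0 = search (M ∸ suc i) (suc i) ℕ.≤-refl (ℕ.m+[n∸m]≡n i<M)
      (ℕ.≤∧≢⇒< z≤ (apart (suc i) ℕ.≤-refl i<M))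
      where
      i : ℕ
      i = flip ρ ⟪ z ⟫
      1≤z : 1 ≤ z
      1≤z = proj₁ (∈letters⁻ {M} (proj₁ (∈-filter⁻ (¬? ∘ descentTop? ρ) z∈)))
      z≤M : z ≤ M
      z≤M = proj₂ (∈letters⁻ {M} (proj₁ (∈-filter⁻ (¬? ∘ descentTop? ρ) z∈)))
      nd : ¬ DescentTop ρ z
      nd = proj₂ (∈-filter⁻ (¬? ∘ descentTop? ρ) {xs = letters M} z∈)
      ρi≡z : ρ ⟪ i ⟫ ≡ z
      ρi≡z = ⟪⟫-flip ρ 1≤z z≤M
      i<M : i < M
      i<M = ℕ.≤∧≢⇒< (⟪⟫-≤ (flip ρ) 1≤z z≤M)
        (λ i≡M → z≢1 (trans (sym ρi≡z) (trans (cong (ρ ⟪_⟫) i≡M) ends)))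
      z≤ : z ≤ ρ ⟪ suc i ⟫
      z≤ = subst (_≤ ρ ⟪ suc i ⟫) ρi≡z (ℕ.≮⇒≥ (λ d → nd (i<M , d)))
      apart : ∀ k → i < k → k ≤ M → z ≢ ρ ⟪ k ⟫
      apart k i<k k≤M e = ℕ.<⇒≢ i<k (trans (cong (flip ρ ⟪_⟫) e)
        (flip-⟪⟫ ρ (ℕ.≤-trans (s≤s z≤n) i<k) k≤M))
      no-crossing : ∀ {j} → i < j → j < M → ρ ⟪ suc j ⟫ < z → ¬ (z < ρ ⟪ j ⟫)
      no-crossing i<j j<M lo hi = ∈⇒length≢0
        (∈-filter⁺ (λ j → i <? j ×-dec j <? M ×-dec ρ ⟪ suc j ⟫ <? z ×-dec z <? ρ ⟪ j ⟫)
          (∈letters⁺ {M} (ℕ.≤-trans (s≤s z≤n) i<j) (ℕ.<⇒≤ j<M)) (i<j , j<M , lo , hi))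
        c≡0
      search : ∀ d k → i < k → k + d ≡ M → ¬ (z < ρ ⟪ k ⟫)
      search zero k i<k e z< =
        ℕ.<⇒≱ (subst (z <_) (trans (cong (ρ ⟪_⟫) (trans (sym (ℕ.+-identityʳ k)) e)) ends) z<) 1≤z
      search (suc d) k i<k e z< = go (ℕ.<-cmp z (ρ ⟪ suc k ⟫))
        where
        e′ : suc k + d ≡ M
        e′ = trans (sym (ℕ.+-suc k d)) e
        k<M : k < M
        k<M = subst (k <_) e′ (s≤s (ℕ.m≤m+n k d))
        i<sk : i < suc k
        i<sk = ℕ.m≤n⇒m≤1+n i<k
        go : Tri (z < ρ ⟪ suc k ⟫) (z ≡ ρ ⟪ suc k ⟫) (z > ρ ⟪ suc k ⟫) → ⊥
        go (tri< lt _ _) = search d (suc k) i<sk e′ lt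
        go (tri≈ _ z≡ _) = apart (suc k) i<sk k<M z≡
        go (tri> _ _ gt) = no-crossing i<k k<M gt z<

    ends-with-1 : ∀ {w} → SmallerToRight (crossings ρ) (nondescentTops ρ) w → ∃ λ v → w ≡ v ∷ʳ 1
    ends-with-1 {w} arr with initLast w
    ... | [] with () ← Perm↭.∈-resp-↭ (↭-sym (arrangement arr))
      (∈-filter⁺ (¬? ∘ descentTop? ρ) (∈letters⁺ ℕ.≤-refl 1≤M)
        (λ (i<M , _) → ℕ.<-irrefl
          (trans (cong (flip ρ ⟪_⟫) (sym ends)) (flip-⟪⟫ ρ 1≤M ℕ.≤-refl))
          i<M))
    ... | v ∷ʳ′ z with z ℕ.≟ 1
    ...   | yes refl = v , refl
    ...   | no z≢1 = contradiction (sym (smaller arr v z [] refl))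
      (crosses (Perm↭.∈-resp-↭ (arrangement arr) (∈-++⁺ʳ v (here refl))) z≢1)

    first-column : ∀ {f g f′ g′ : List ℕ} → f ++ g ↭ letters M → f′ ++ g′ ↭ letters M →
      (∃ λ v → g ≡ v ∷ʳ M) → (∃ λ w → g′ ≡ w ∷ʳ 1) → (M , 1) ∈ zip (f ++ g) (f′ ++ g′)
    first-column {f} {_} {f′} p q (v , refl) (w , refl)
      rewrite sym (List.++-assoc f v (M ∷ [])) | sym (List.++-assoc f′ w (1 ∷ [])) =
      last-zip (f ++ v) (f′ ++ w) (Perm↭.↭-length (↭-trans p (↭-sym q)))

  Φ-first : Φ ρ ⟪ 1 ⟫ ≡ M
  Φ-first = Φ-column ρ (first-column {f ρ} {g ρ} {f′ ρ} {g′ ρ} (top-↭ ρ) (bottom-↭ ρ)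
    g-last (ends-with-1 (g′-arranged ρ)))

remove-largest : (τ : Permutation′ (suc m)) → τ ⟪ 1 ⟫ ≡ suc m →
  ∀ {i} → 1 ≤ i → i ≤ m → remove zero τ ⟪ i ⟫ ≡ τ ⟪ suc i ⟫
remove-largest {m} τ first 1≤i i≤m with k , refl ← toFin 1≤i i≤m = begin
  τ′ ⟪ suc (toℕ k) ⟫                                ≡⟨ ⟪⟫-toℕ τ′ k ⟩
  suc (toℕ (τ′ ⟨$⟩ʳ k))                             ≡⟨ cong suc (punchIn-largest _ largest) ⟨
  suc (toℕ (punchIn (τ ⟨$⟩ʳ zero) (τ′ ⟨$⟩ʳ k)))     ≡⟨ cong (suc ∘ toℕ) (Perm.punchIn-permute τ zero k) ⟨
  suc (toℕ (τ ⟨$⟩ʳ suc k))                          ≡⟨ ⟪⟫-toℕ τ (suc k) ⟨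
  τ ⟪ suc (suc (toℕ k)) ⟫                           ∎
  where
  open ≡-Reasoning
  τ′ = remove zero τ
  largest : toℕ (τ ⟨$⟩ʳ zero) ≡ m
  largest = ℕ.suc-injective (trans (sym (⟪⟫-toℕ τ zero)) first)
  punchIn-largest : ∀ {m} {t : Fin (suc m)} (k : Fin m) → toℕ t ≡ m → toℕ (punchIn t k) ≡ toℕ k
  punchIn-largest {t = zero} () refl
  punchIn-largest {t = suc t} zero _ = refl
  punchIn-largest {t = suc t} (suc k) e = cong suc (punchIn-largest k (ℕ.suc-injective e))

infix 30 _^

_^ : Permutation′ m → Permutation′ (suc m)
_^ {m} ρ = insert (fromℕ m) zero ρ

^-⟪⟫ : (ρ : Permutation′ m) → ∀ {i} → 1 ≤ i → i ≤ m → ρ ^ ⟪ i ⟫ ≡ suc (ρ ⟪ i ⟫)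
^-⟪⟫ {m} ρ 1≤i i≤m with k , refl ← toFin 1≤i i≤m = begin
  ρ ^ ⟪ suc (toℕ k) ⟫                            ≡⟨ cong (λ l → ρ ^ ⟪ suc l ⟫) toℕ-k ⟨
  ρ ^ ⟪ suc (toℕ (punchIn (fromℕ m) k)) ⟫ ≡⟨ ⟪⟫-toℕ (ρ ^) (punchIn (fromℕ m) k) ⟩
  suc (toℕ (ρ ^ ⟨$⟩ʳ punchIn (fromℕ m) k)) ≡⟨ cong (suc ∘ toℕ) (Perm.insert-punchIn (fromℕ m) zero ρ k) ⟩
  suc (suc (toℕ (ρ ⟨$⟩ʳ k)))                     ≡⟨ cong suc (⟪⟫-toℕ ρ k) ⟨
  suc (ρ ⟪ suc (toℕ k) ⟫)                        ∎
  where
  open ≡-Reasoning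
  punchIn-last : ∀ {m} (k : Fin m) → toℕ (punchIn (fromℕ m) k) ≡ toℕ k
  punchIn-last zero = refl
  punchIn-last (suc k) = cong suc (punchIn-last k)
  toℕ-k = punchIn-last k

^-last : (ρ : Permutation′ m) → ρ ^ ⟪ suc m ⟫ ≡ 1
^-last {m} ρ = begin
  ρ ^ ⟪ suc m ⟫                   ≡⟨ cong (λ l → ρ ^ ⟪ suc l ⟫) (Fin.toℕ-fromℕ m) ⟨
  ρ ^ ⟪ suc (toℕ (fromℕ m)) ⟫     ≡⟨ ⟪⟫-toℕ (ρ ^) (fromℕ m) ⟩
  suc (toℕ (ρ ^ ⟨$⟩ʳ fromℕ m))    ≡⟨ cong (suc ∘ toℕ) lemma ⟩
  1                               ∎
  where
  open ≡-Reasoning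
  lemma : insert (fromℕ m) zero ρ ⟨$⟩ʳ fromℕ m ≡ zero
  lemma with fromℕ m Fin.≟ fromℕ m
  ... | yes _ = refl
  ... | no ¬e = contradiction refl ¬e

-- Removing position 1 relabels the remaining values to {1,…,m}.  This leaves
-- them unchanged since the removed value is the largest one: see Φ^-first and
-- Ψ-⟪⟫.

Ψ : Permutation′ m → Permutation′ m
Ψ ρ = remove zero (Φ (ρ ^))

Φ^-first : (ρ : Permutation′ m) → Φ (ρ ^) ⟪ 1 ⟫ ≡ suc m
Φ^-first ρ = Φ-first (s≤s z≤n) (ρ ^) (^-last ρ)

Ψ-⟪⟫ : (ρ : Permutation′ m) → ∀ {i} → 1 ≤ i → i ≤ m → Ψ ρ ⟪ i ⟫ ≡ Φ (ρ ^) ⟪ suc i ⟫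
Ψ-⟪⟫ ρ = remove-largest (Φ (ρ ^)) (Φ^-first ρ)

{-# OPTIONS --safe #-}
module Submission where

-- Put ρ = σ^, τ = Φ(ρ) and b = i + 1.  The map τ sends descent tops to descent
-- bottoms and nondescent tops to nondescent bottoms.  Counting the descents on
-- either side of a level and across it shows τ(b) < b for descent tops b and
-- τ(b) ≥ b for the others.  Hence the steps of ψYZL(Ψ(σ)) record whether b is a
-- descent top and whether it is a descent bottom of ρ, that is, the kind of i
-- in σ.  It also follows that the letters nesting over b are those counted by
-- the arrangement of the bottom row, so that nest is the number c(b) of
-- descents of ρ across b to the right of b, less 1 (for the removed first
-- letter of τ) if b is a nondescent top.  Since ρ ends below b, its ascents and
-- descents across b alternate, which makes this the number of ascents of σ
-- across i to the right of i.

open import Defs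
open LargerToLeft
open SmallerToRight
open import Data.Bool using (Bool; false; if_then_else_)
import Data.Fin.Properties as Fin
open import Data.Fin.Permutation using (Permutation′; flip)
open import Data.List using (List; []; _∷_; _++_; length; filter; map; zip)
import Data.List.Properties as List
open import Data.List.Membership.Propositional using (_∈_; _∉_)
open import Data.List.Membership.Propositional.Properties
  using (∈-filter⁺; ∈-filter⁻; ∈-∃++; ∈-++⁺ˡ; ∈-++⁺ʳ; ∈-++⁻; ∈-map⁺; ∈-map⁻; ∈-insert)
open import Data.List.Relation.Binary.Permutation.Propositional using (↭-sym; ↭-trans; ↭⇒↭ₛ)
import Data.List.Relation.Binary.Permutation.Propositional.Properties as Perm↭
import Data.List.Relation.Binary.Permutation.Setoid.Properties as SetoidPermP
open import Data.List.Relation.Unary.All as All using (All; []; _∷_)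
import Data.List.Relation.Unary.All.Properties as AllP
open import Data.List.Relation.Unary.AllPairs as AllPairs using (AllPairs; []; _∷_)
import Data.List.Relation.Unary.AllPairs.Properties as AllPairsP
open import Data.List.Relation.Unary.Any using (here; there)
open import Data.List.Relation.Unary.Unique.Propositional using (Unique)
import Data.List.Relation.Unary.Unique.Propositional.Properties as Unique
open import Data.Nat
  using (ℕ; zero; suc; _+_; _∸_; _≤_; _<_; _>_; z≤n; s≤s; _<?_; _≤?_; pred)
import Data.Nat.Properties as ℕ
open import Data.Product using (_×_; _,_; proj₁; proj₂)
open import Data.Sum using (_⊎_; inj₁; inj₂)
open import Data.Vec.Properties using (tabulate-cong)
open import Function using (_∘_; id)
open import Level using (0ℓ)
open import Relation.Binary using (tri<; tri≈; tri>)
open import Relation.Binary.PropositionalEquality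
open import Relation.Nullary using (¬_; yes; no; does; contradiction)
open import Relation.Nullary.Decidable using (_×-dec_; _⊎-dec_; ¬?; dec-true; dec-false)
open import Relation.Unary using (Pred; Decidable)

private
  variable
    m : ℕ

-- Counting by injections and bijections between repetition-free lists.

pigeonhole-≡ : (f g : ℕ → ℕ) {xs ys : List ℕ} → Unique xs → Unique ys →
  (∀ {x} → x ∈ xs → f x ∈ ys × g (f x) ≡ x) →
  (∀ {y} → y ∈ ys → g y ∈ xs × f (g y) ≡ y) →
  length xs ≡ length ys
pigeonhole-≡ f g xs! ys! to from = ℕ.≤-antisym
  (pigeonhole f g xs! (proj₂ ∘ to) (proj₁ ∘ to))
  (pigeonhole g f ys! (proj₂ ∘ from) (proj₁ ∘ from))

length-⊆ : {xs ys : List ℕ} → Unique xs → (∀ {x} → x ∈ xs → x ∈ ys) → length xs ≤ length ys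
length-⊆ xs! = pigeonhole id id xs! (λ _ → refl)

letters-! : ∀ m → Unique (letters m)
letters-! m = AllPairs.map ℕ.<⇒≢ (letters-< m)

∉⇒All≢ : ∀ {x} {xs : List ℕ} → x ∉ xs → All (x ≢_) xs
∉⇒All≢ x∉ = All.tabulate λ y∈ x≡y → x∉ (subst (_∈ _) (sym x≡y) y∈)

unique-++⁻ : ∀ (xs : List ℕ) {ys} → Unique (xs ++ ys) → Unique xs × Unique ys
unique-++⁻ [] ys! = [] , ys!
unique-++⁻ (x ∷ xs) (x∉ ∷ xs!) with p , q ← unique-++⁻ xs xs! = AllP.++⁻ˡ xs x∉ ∷ p , q

module _ {P : Pred ℕ 0ℓ} (P? : Decidable P) where

  length-filter-split : ∀ xs → length xs ≡ length (filter P? xs) + length (filter (¬? ∘ P?) xs)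
  length-filter-split xs = trans (sym (Perm↭.↭-length (filter-++-filter P? xs)))
                                 (List.length-++ (filter P? xs))

  length-filter-filter : {Q : Pred ℕ 0ℓ} (Q? : Decidable Q) → ∀ xs → length (filter Q? xs) ≡
    length (filter Q? (filter P? xs)) + length (filter Q? (filter (¬? ∘ P?) xs))
  length-filter-filter Q? xs = begin
    length (filter Q? xs)                                       ≡⟨ Perm↭.↭-length (Perm↭.filter-↭ Q? (filter-++-filter P? xs)) ⟨
    length (filter Q? (filter P? xs ++ filter (¬? ∘ P?) xs))    ≡⟨ cong length (List.filter-++ Q? (filter P? xs) _) ⟩
    length (filter Q? (filter P? xs) ++ filter Q? (filter (¬? ∘ P?) xs)) ≡⟨ List.length-++ (filter Q? (filter P? xs)) ⟩
    length (filter Q? (filter P? xs)) + length (filter Q? (filter (¬? ∘ P?) xs)) ∎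
    where open ≡-Reasoning

-- Words whose images under a map increase.

map≡⁺ : (h : ℕ → ℕ) (as bs : List ℕ) → length as ≡ length bs →
  (∀ {a b} → (a , b) ∈ zip as bs → h b ≡ a) → map h bs ≡ as
map≡⁺ h [] [] _ _ = refl
map≡⁺ h (a ∷ as) (b ∷ bs) len eq =
  cong₂ _∷_ (eq (here refl)) (map≡⁺ h as bs (ℕ.suc-injective len) (eq ∘ there))

++-injective : ∀ {as cs bs ds : List ℕ} → length as ≡ length bs →
  as ++ cs ≡ bs ++ ds → as ≡ bs × cs ≡ ds
++-injective {[]} {bs = []} _ eq = refl , eq
++-injective {a ∷ as} {bs = b ∷ bs} len eq with refl , eq′ ← List.∷-injective eq
  with refl , e ← ++-injective {as} {bs = bs} (ℕ.suc-injective len) eq′ = refl , e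

module _ (h : ℕ → ℕ) {u v : List ℕ} {b : ℕ} (inc : AllPairs _<_ (map h (u ++ b ∷ v))) where

  private
    inc′ : AllPairs _<_ (map h u ++ map h (b ∷ v))
    inc′ = subst (AllPairs _<_) (List.map-++ h u (b ∷ v)) inc

  increasing-left : ∀ {y} → y ∈ u → h y < h b
  increasing-left = go u inc′
    where
    go : ∀ u {y} → AllPairs _<_ (map h u ++ map h (b ∷ v)) → y ∈ u → h y < h b
    go (_ ∷ u) (p ∷ _) (here refl) = All.lookup p (∈-insert (map h u))
    go (_ ∷ u) (_ ∷ ap) (there y∈) = go u ap y∈

  increasing-right : ∀ {y} → y ∈ v → h b < h y
  increasing-right y∈ = All.lookup (go u inc′) (∈-map⁺ h y∈)
    where
    go : ∀ u → AllPairs _<_ (map h u ++ map h (b ∷ v)) → All (h b <_) (map h v)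
    go [] (p ∷ _) = p
    go (_ ∷ u) (_ ∷ ap) = go u ap

  -- Images increase along the word, so an image below `h b` can only come from a letter of `u`.
  -- Together with `length-larger` this bounds from below the number of letters on one side of `b`.
  length-smaller : ∀ {a} → a ≤ h b → length (filter (_<? a) (map h (u ++ b ∷ v))) ≤ length u
  length-smaller {a} a≤ = ℕ.≤-trans
    (length-⊆ (AllPairs.map ℕ.<⇒≢ (AllPairsP.filter⁺ (_<? a) inc)) into)
    (ℕ.≤-reflexive (List.length-map h u))
    where
    into : ∀ {x} → x ∈ filter (_<? a) (map h (u ++ b ∷ v)) → x ∈ map h u
    into x∈ with x∈′ , x<a ← ∈-filter⁻ (_<? a) x∈
      with y , y∈ , refl ← ∈-map⁻ h {xs = u ++ b ∷ v} x∈′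
      with ∈-++⁻ u y∈
    ... | inj₁ y∈u = ∈-map⁺ h y∈u
    ... | inj₂ (here refl) = contradiction a≤ (ℕ.<⇒≱ x<a)
    ... | inj₂ (there y∈v) = contradiction
      (ℕ.≤-trans a≤ (ℕ.<⇒≤ (increasing-right y∈v))) (ℕ.<⇒≱ x<a)

  length-larger : ∀ {a} → h b < a → length (filter (a ≤?_) (map h (u ++ b ∷ v))) ≤ length v
  length-larger {a} <a = ℕ.≤-trans
    (length-⊆ (AllPairs.map ℕ.<⇒≢ (AllPairsP.filter⁺ (a ≤?_) inc)) into)
    (ℕ.≤-reflexive (List.length-map h v))
    where
    into : ∀ {x} → x ∈ filter (a ≤?_) (map h (u ++ b ∷ v)) → x ∈ map h v
    into x∈ with x∈′ , a≤x ← ∈-filter⁻ (a ≤?_) x∈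
      with y , y∈ , refl ← ∈-map⁻ h {xs = u ++ b ∷ v} x∈′
      with ∈-++⁻ u y∈
    ... | inj₁ y∈u = contradiction a≤x (ℕ.<⇒≱ (ℕ.<-trans (increasing-left y∈u) <a))
    ... | inj₂ (here refl) = contradiction a≤x (ℕ.<⇒≱ <a)
    ... | inj₂ (there y∈v) = ∈-map⁺ h y∈v

module _ {c : ℕ → ℕ} {xs w : List ℕ} (h : ℕ → ℕ)
  (arr : LargerToLeft c xs w) (w! : Unique w) (inc : AllPairs _<_ (map h w)) where

  -- In a word u b v the letters of u are those with smaller images than b, and
  -- c b of them are larger than b.

  image-<-larger : ∀ {b} → b ∈ w →
    c b + length (filter (_<? b) xs) < length (filter (_<? b) (map h w)) → h b < b
  image-<-larger {b} b∈ lt with u , v , refl ← ∈-∃++ b∈ =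
    ℕ.≰⇒> λ b≤a → ℕ.<⇒≱ lt (begin
      length (filter (_<? b) (map h (u ++ b ∷ v)))      ≤⟨ length-smaller h inc b≤a ⟩
      length u                                          ≡⟨ length-filter-split (b <?_) u ⟩
      length (filter (b <?_) u) + length (filter (¬? ∘ (b <?_)) u) ≡⟨ cong (_+ length (filter (¬? ∘ (b <?_)) u)) (larger arr u b v refl) ⟩
      c b + length (filter (¬? ∘ (b <?_)) u)            ≤⟨ ℕ.+-monoʳ-≤ (c b) (length-⊆ (Unique.filter⁺ (¬? ∘ (b <?_)) (proj₁ (unique-++⁻ u w!))) into) ⟩
      c b + length (filter (_<? b) xs)                  ∎)
    where
    open ℕ.≤-Reasoning
    into : ∀ {x} → x ∈ filter (¬? ∘ (b <?_)) u → x ∈ filter (_<? b) xs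
    into {x} x∈ with x∈u , b≮x ← ∈-filter⁻ (¬? ∘ (b <?_)) {xs = u} x∈ =
      ∈-filter⁺ (_<? b) (Perm↭.∈-resp-↭ (arrangement arr) (∈-++⁺ˡ x∈u))
        (ℕ.≤∧≢⇒< (ℕ.≮⇒≥ b≮x) λ x≡b → ℕ.<-irrefl (cong h x≡b) (increasing-left h inc x∈u))

  -- Since images increase along `w`, standing to the left of `b` is the same as having a smaller
  -- image. The arrangement condition thus becomes a count that no longer mentions positions in `w`.
  count-larger : ∀ {b} → b ∈ w → c b ≡ length (filter (λ y → b <? y ×-dec h y <? h b) w)
  count-larger {b} b∈ with u , v , refl ← ∈-∃++ b∈ =
    trans (sym (larger arr u b v refl)) (ℕ.≤-antisym
      (length-⊆ (Unique.filter⁺ (b <?_) (proj₁ (unique-++⁻ u w!))) to)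
      (length-⊆ (Unique.filter⁺ P? w!) from))
    where
    P? = λ y → b <? y ×-dec h y <? h b
    to : ∀ {y} → y ∈ filter (b <?_) u → y ∈ filter P? (u ++ b ∷ v)
    to y∈ with y∈u , b<y ← ∈-filter⁻ (b <?_) {xs = u} y∈ =
      ∈-filter⁺ P? (∈-++⁺ˡ y∈u) (b<y , increasing-left h inc y∈u)
    from : ∀ {y} → y ∈ filter P? (u ++ b ∷ v) → y ∈ filter (b <?_) u
    from y∈ with y∈w , b<y , hy<hb ← ∈-filter⁻ P? {xs = u ++ b ∷ v} y∈ with ∈-++⁻ u y∈w
    ... | inj₁ y∈u = ∈-filter⁺ (b <?_) y∈u b<y
    ... | inj₂ (here refl) = contradiction b<y (ℕ.<-irrefl refl)
    ... | inj₂ (there y∈v) = contradiction hy<hb (ℕ.<-asym (increasing-right h {u} inc y∈v))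

module _ {c : ℕ → ℕ} {xs w : List ℕ} (h : ℕ → ℕ)
  (arr : SmallerToRight c xs w) (w! : Unique w) (inc : AllPairs _<_ (map h w)) where

  -- Mirror of `image-<-larger`: if `h b < b`, all images that are at least `b` come from letters to
  -- the right of `b`. Of these, `c b` are smaller than `b` and the others are among the larger
  -- letters of `xs`, which is too few.
  image-≥-smaller : ∀ {b} → b ∈ w →
    c b + length (filter (b <?_) xs) < length (filter (b ≤?_) (map h w)) → b ≤ h b
  image-≥-smaller {b} b∈ lt with u , v , refl ← ∈-∃++ b∈
    with _ , _ ∷ v! ← unique-++⁻ u w! =
    ℕ.≮⇒≥ λ a<b → ℕ.<⇒≱ lt (begin
      length (filter (b ≤?_) (map h (u ++ b ∷ v)))      ≤⟨ length-larger h inc a<b ⟩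
      length v                                          ≡⟨ length-filter-split (_<? b) v ⟩
      length (filter (_<? b) v) + length (filter (¬? ∘ (_<? b)) v) ≡⟨ cong (_+ length (filter (¬? ∘ (_<? b)) v)) (smaller arr u b v refl) ⟩
      c b + length (filter (¬? ∘ (_<? b)) v)            ≤⟨ ℕ.+-monoʳ-≤ (c b) (length-⊆ (Unique.filter⁺ (¬? ∘ (_<? b)) v!) into) ⟩
      c b + length (filter (b <?_) xs)                  ∎)
    where
    open ℕ.≤-Reasoning
    into : ∀ {x} → x ∈ filter (¬? ∘ (_<? b)) v → x ∈ filter (b <?_) xs
    into {x} x∈ with x∈v , x≮b ← ∈-filter⁻ (¬? ∘ (_<? b)) {xs = v} x∈ =
      ∈-filter⁺ (b <?_) (Perm↭.∈-resp-↭ (arrangement arr) (∈-++⁺ʳ u (there x∈v)))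
        (ℕ.≤∧≢⇒< (ℕ.≮⇒≥ x≮b) λ b≡x → ℕ.<-irrefl (cong h b≡x) (increasing-right h {u} inc x∈v))

  -- As in `count-larger`, with "to the right" now meaning "with larger image".
  count-smaller : ∀ {b} → b ∈ w → c b ≡ length (filter (λ y → y <? b ×-dec h b <? h y) w)
  count-smaller {b} b∈ with u , v , refl ← ∈-∃++ b∈
    with _ , _ ∷ v! ← unique-++⁻ u w! =
    trans (sym (smaller arr u b v refl)) (ℕ.≤-antisym
      (length-⊆ (Unique.filter⁺ (_<? b) v!) to)
      (length-⊆ (Unique.filter⁺ P? w!) from))
    where
    P? = λ y → y <? b ×-dec h b <? h y
    to : ∀ {y} → y ∈ filter (_<? b) v → y ∈ filter P? (u ++ b ∷ v)
    to y∈ with y∈v , y<b ← ∈-filter⁻ (_<? b) {xs = v} y∈ =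
      ∈-filter⁺ P? (∈-++⁺ʳ u (there y∈v)) (y<b , increasing-right h {u} inc y∈v)
    from : ∀ {y} → y ∈ filter P? (u ++ b ∷ v) → y ∈ filter (_<? b) v
    from y∈ with y∈w , y<b , hb<hy ← ∈-filter⁻ P? {xs = u ++ b ∷ v} y∈ with ∈-++⁻ u y∈w
    ... | inj₁ y∈u = contradiction hb<hy (ℕ.<-asym (increasing-left h inc y∈u))
    ... | inj₂ (here refl) = contradiction y<b (ℕ.<-irrefl refl)
    ... | inj₂ (there y∈v) = ∈-filter⁺ (_<? b) y∈v y<b

-- Descents counted by tops and by bottoms, relative to a level.

module _ {M : ℕ} (ρ : Permutation′ M) where

  private
    pos next prev : ℕ → ℕ
    pos x = flip ρ ⟪ x ⟫
    next x = ρ ⟪ suc (pos x) ⟫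
    prev x = ρ ⟪ pos x ∸ 1 ⟫

    DT DB NT NB : List ℕ
    DT = descentTops ρ
    DB = descentBottoms ρ
    NT = nondescentTops ρ
    NB = nondescentBottoms ρ

    top⁺ : ∀ {x} → 1 ≤ x → x ≤ M → pos x < M → next x < x → x ∈ DT
    top⁺ {x} 1≤x x≤M p<M d = ∈-filter⁺ (descentTop? ρ) (∈letters⁺ 1≤x x≤M)
      (p<M , subst (next x <_) (sym (⟪⟫-flip ρ 1≤x x≤M)) d)

    top⁻ : ∀ {x} → x ∈ DT → (1 ≤ x × x ≤ M) × pos x < M × next x < x
    top⁻ {x} x∈ with x∈l , p<M , d ← ∈-filter⁻ (descentTop? ρ) {xs = letters M} x∈
      with 1≤x , x≤M ← ∈letters⁻ {M} x∈l =
      (1≤x , x≤M) , p<M , subst (next x <_) (⟪⟫-flip ρ 1≤x x≤M) d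

    bottom⁺ : ∀ {x} → 1 ≤ x → x ≤ M → 2 ≤ pos x → x < prev x → x ∈ DB
    bottom⁺ {x} 1≤x x≤M 2≤p d = ∈-filter⁺ (descentBottom? ρ) (∈letters⁺ 1≤x x≤M)
      (2≤p , subst (_< prev x) (sym (⟪⟫-flip ρ 1≤x x≤M)) d)

    bottom⁻ : ∀ {x} → x ∈ DB → (1 ≤ x × x ≤ M) × 2 ≤ pos x × x < prev x
    bottom⁻ {x} x∈ with x∈l , 2≤p , d ← ∈-filter⁻ (descentBottom? ρ) {xs = letters M} x∈
      with 1≤x , x≤M ← ∈letters⁻ {M} x∈l =
      (1≤x , x≤M) , 2≤p , subst (_< prev x) (⟪⟫-flip ρ 1≤x x≤M) d

    -- With `prev-top`, this matches the two letters of each descent, so that descents can be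
    -- counted by their tops or by their bottoms.
    next-bottom : ∀ {x} → x ∈ DT → next x ∈ DB × prev (next x) ≡ x
    next-bottom {x} x∈ with (1≤x , x≤M) , p<M , d ← top⁻ x∈ =
      bottom⁺ (⟪⟫-pos ρ (s≤s z≤n) p<M) (⟪⟫-≤ ρ (s≤s z≤n) p<M)
        (subst (2 ≤_) (sym posn) (s≤s (⟪⟫-pos (flip ρ) 1≤x x≤M)))
        (subst (next x <_) (sym prevn) d) ,
      prevn
      where
      posn : pos (next x) ≡ suc (pos x)
      posn = flip-⟪⟫ ρ (s≤s z≤n) p<M
      prevn : prev (next x) ≡ x
      prevn = trans (cong (λ i → ρ ⟪ i ∸ 1 ⟫) posn) (⟪⟫-flip ρ 1≤x x≤M)

    prev-top : ∀ {x} → x ∈ DB → prev x ∈ DT × next (prev x) ≡ x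
    prev-top {x} x∈ with (1≤x , x≤M) , 2≤p , d ← bottom⁻ x∈
      with pos x in eq
    ... | suc (suc i) =
      top⁺ (⟪⟫-pos ρ (s≤s z≤n) si≤M) (⟪⟫-≤ ρ (s≤s z≤n) si≤M)
        (subst (_< M) (sym posp) ssi≤M) (subst (_< ρ ⟪ suc i ⟫) (sym nextp) d) ,
      nextp
      where
      ssi≤M : suc (suc i) ≤ M
      ssi≤M = subst (_≤ M) eq (⟪⟫-≤ (flip ρ) 1≤x x≤M)
      si≤M : suc i ≤ M
      si≤M = ℕ.<⇒≤ ssi≤M
      posp : pos (ρ ⟪ suc i ⟫) ≡ suc i
      posp = flip-⟪⟫ ρ (s≤s z≤n) si≤M
      nextp : next (ρ ⟪ suc i ⟫) ≡ x
      nextp = trans (cong (λ j → ρ ⟪ suc j ⟫) posp)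
                    (trans (cong (ρ ⟪_⟫) (sym eq)) (⟪⟫-flip ρ 1≤x x≤M))

    sorted : ∀ {P : Pred ℕ 0ℓ} (P? : Decidable P) → AllPairs _<_ (filter P? (letters M))
    sorted P? = AllPairsP.filter⁺ P? (letters-< M)

    unique : ∀ {P Q : Pred ℕ 0ℓ} (P? : Decidable P) (Q? : Decidable Q) →
      Unique (filter Q? (filter P? (letters M)))
    unique P? Q? = Unique.filter⁺ Q? (Unique.filter⁺ P? (letters-! M))

    crossing? : ∀ x → Decidable (λ y → next y < x × x < y)
    crossing? x y = next y <? x ×-dec x <? y

    -- In general this is not an equality: `crossings` takes only the descents across `x` to the
    -- right of `x`, `crossing?` those anywhere in the word, each named by its top.
    crossings-≤ : ∀ x → crossings ρ x ≤ length (filter (crossing? x) DT)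
    crossings-≤ x = pigeonhole (ρ ⟪_⟫) pos (Unique.filter⁺ P? (letters-! M)) (proj₂ ∘ into) (proj₁ ∘ into)
      where
      P? = λ j → pos x <? j ×-dec j <? M ×-dec ρ ⟪ suc j ⟫ <? x ×-dec x <? ρ ⟪ j ⟫
      into : ∀ {j} → j ∈ filter P? (letters M) →
        ρ ⟪ j ⟫ ∈ filter (crossing? x) DT × pos (ρ ⟪ j ⟫) ≡ j
      into {j} j∈ with j∈l , _ , j<M , lo , hi ← ∈-filter⁻ P? {xs = letters M} j∈
        with 1≤j , j≤M ← ∈letters⁻ {M} j∈l =
        ∈-filter⁺ (crossing? x)
          (top⁺ (⟪⟫-pos ρ 1≤j j≤M) (⟪⟫-≤ ρ 1≤j j≤M) (subst (_< M) (sym pj) j<M)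
            (ℕ.<-trans lo′ hi))
          (lo′ , hi) ,
        pj
        where
        pj : pos (ρ ⟪ j ⟫) ≡ j
        pj = flip-⟪⟫ ρ 1≤j j≤M
        lo′ : next (ρ ⟪ j ⟫) < x
        lo′ = subst (λ i → ρ ⟪ suc i ⟫ < x) (sym pj) lo

  length-bottoms : length DB ≡ length DT
  length-bottoms = pigeonhole-≡ prev next (Unique.filter⁺ (descentBottom? ρ) (letters-! M))
    (Unique.filter⁺ (descentTop? ρ) (letters-! M)) prev-top next-bottom

  -- A descent with top at most b has its bottom below b, and so does one
  -- which crosses b.

  tops-<-bottoms : ∀ {b} → b ∈ DT →
    crossings ρ b + length (filter (_<? b) DT) < length (filter (_<? b) DB)
  tops-<-bottoms {b} b∈ = ℕ.≤-trans
    (s≤s (ℕ.≤-trans (ℕ.+-monoˡ-≤ _ (crossings-≤ b)) (ℕ.≤-reflexive (sym (List.length-++ C)))))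
    (pigeonhole next prev (∉⇒All≢ b∉ ∷ CS!) (λ {x} x∈ → proj₂ (next-bottom (tops x∈)))
      (λ x∈ → ∈-filter⁺ (_<? b) (proj₁ (next-bottom (tops x∈))) (below x∈)))
    where
    C S : List ℕ
    C = filter (crossing? b) DT
    S = filter (_<? b) DT
    CS! : Unique (C ++ S)
    CS! = Unique.++⁺ (unique (descentTop? ρ) (crossing? b)) (unique (descentTop? ρ) (_<? b))
      λ (x∈C , x∈S) → ℕ.<-asym (proj₂ (proj₂ (∈-filter⁻ (crossing? b) {xs = DT} x∈C)))
                                (proj₂ (∈-filter⁻ (_<? b) {xs = DT} x∈S))
    -- The descent with top `b` belongs to neither family; it is the element that makes the
    -- inequality strict.
    b∉ : b ∉ C ++ S
    b∉ x∈ with ∈-++⁻ C x∈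
    ... | inj₁ x∈C = ℕ.<-irrefl refl (proj₂ (proj₂ (∈-filter⁻ (crossing? b) {xs = DT} x∈C)))
    ... | inj₂ x∈S = ℕ.<-irrefl refl (proj₂ (∈-filter⁻ (_<? b) {xs = DT} x∈S))
    tops : ∀ {x} → x ∈ b ∷ C ++ S → x ∈ DT
    tops (here refl) = b∈
    tops (there x∈) with ∈-++⁻ C x∈
    ... | inj₁ x∈C = proj₁ (∈-filter⁻ (crossing? b) x∈C)
    ... | inj₂ x∈S = proj₁ (∈-filter⁻ (_<? b) x∈S)
    below : ∀ {x} → x ∈ b ∷ C ++ S → next x < b
    below (here refl) = proj₂ (proj₂ (top⁻ b∈))
    below (there x∈) with ∈-++⁻ C x∈
    ... | inj₁ x∈C = proj₁ (proj₂ (∈-filter⁻ (crossing? b) {xs = DT} x∈C))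
    ... | inj₂ x∈S with x∈ , x<b ← ∈-filter⁻ (_<? b) {xs = DT} x∈S =
      ℕ.<-trans (proj₂ (proj₂ (top⁻ x∈))) x<b

  -- A descent across `b` has its bottom below `b`, so it differs from every descent with bottom at
  -- least `b`; descents of both sorts have their tops above `b`.
  bottoms-≤-tops : ∀ b →
    crossings ρ b + length (filter (b ≤?_) DB) ≤ length (filter (b <?_) DT)
  bottoms-≤-tops b = ℕ.≤-trans
    (ℕ.+-mono-≤ (crossings-≤ b) (pigeonhole prev next (unique (descentBottom? ρ) (b ≤?_))
      (λ x∈ → proj₂ (prev-top (proj₁ (∈-filter⁻ (b ≤?_) x∈)))) into))
    (ℕ.≤-trans (ℕ.≤-reflexive (sym (List.length-++ C))) (length-⊆ CB! tops))
    where
    C B : List ℕ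
    C = filter (crossing? b) DT
    B = filter (λ y → b ≤? next y) DT
    into : ∀ {x} → x ∈ filter (b ≤?_) DB → prev x ∈ B
    into x∈ with x∈ , b≤x ← ∈-filter⁻ (b ≤?_) {xs = DB} x∈ =
      ∈-filter⁺ (λ y → b ≤? next y) (proj₁ (prev-top x∈))
        (subst (b ≤_) (sym (proj₂ (prev-top x∈))) b≤x)
    CB! : Unique (C ++ B)
    CB! = Unique.++⁺ (unique (descentTop? ρ) (crossing? b))
      (unique (descentTop? ρ) (λ y → b ≤? next y))
      λ (x∈C , x∈B) → ℕ.<⇒≱ (proj₁ (proj₂ (∈-filter⁻ (crossing? b) {xs = DT} x∈C)))
                              (proj₂ (∈-filter⁻ (λ y → b ≤? next y) {xs = DT} x∈B))
    tops : ∀ {x} → x ∈ C ++ B → x ∈ filter (b <?_) DT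
    tops x∈ with ∈-++⁻ C x∈
    ... | inj₁ x∈C with x∈ , _ , b<x ← ∈-filter⁻ (crossing? b) {xs = DT} x∈C =
      ∈-filter⁺ (b <?_) x∈ b<x
    ... | inj₂ x∈B with x∈ , b≤ ← ∈-filter⁻ (λ y → b ≤? next y) {xs = DT} x∈B =
      ∈-filter⁺ (b <?_) x∈ (ℕ.≤-<-trans b≤ (proj₂ (proj₂ (top⁻ x∈))))

  -- Passes to complements in `bottoms-≤-tops`. The letters above `b` split into tops and nontops,
  -- the letters from `b` on into bottoms and nonbottoms, and the second set has the additional
  -- letter `b`, whence strictness.
  nontops-<-nonbottoms : ∀ {b} → 1 ≤ b → b ≤ M →
    crossings ρ b + length (filter (b <?_) NT) < length (filter (b ≤?_) NB)
  nontops-<-nonbottoms {b} 1≤b b≤M = ℕ.+-cancelˡ-< (# (b ≤?_) DB) _ _ (begin-strict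
    # (b ≤?_) DB + (crossings ρ b + # (b <?_) NT)   ≡⟨ ℕ.+-assoc (# (b ≤?_) DB) _ _ ⟨
    # (b ≤?_) DB + crossings ρ b + # (b <?_) NT     ≡⟨ cong (_+ # (b <?_) NT) (ℕ.+-comm (# (b ≤?_) DB) _) ⟩
    crossings ρ b + # (b ≤?_) DB + # (b <?_) NT     ≤⟨ ℕ.+-monoˡ-≤ _ (bottoms-≤-tops b) ⟩
    # (b <?_) DT + # (b <?_) NT                     ≡⟨ length-filter-filter (descentTop? ρ) (b <?_) (letters M) ⟨
    # (b <?_) (letters M)                           <⟨ length-⊆ b∷! into ⟩
    # (b ≤?_) (letters M)                           ≡⟨ length-filter-filter (descentBottom? ρ) (b ≤?_) (letters M) ⟩
    # (b ≤?_) DB + # (b ≤?_) NB                     ∎)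
    where
    open ℕ.≤-Reasoning
    # : {P : Pred ℕ 0ℓ} → Decidable P → List ℕ → ℕ
    # P? xs = length (filter P? xs)
    b∷! : Unique (b ∷ filter (b <?_) (letters M))
    b∷! = ∉⇒All≢ (λ b∈ → ℕ.<-irrefl refl (proj₂ (∈-filter⁻ (b <?_) {xs = letters M} b∈)))
        ∷ Unique.filter⁺ (b <?_) (letters-! M)
    into : ∀ {x} → x ∈ b ∷ filter (b <?_) (letters M) → x ∈ filter (b ≤?_) (letters M)
    into (here refl) = ∈-filter⁺ (b ≤?_) (∈letters⁺ 1≤b b≤M) ℕ.≤-refl
    into (there x∈) with x∈ , b<x ← ∈-filter⁻ (b <?_) {xs = letters M} x∈ =
      ∈-filter⁺ (b ≤?_) x∈ (ℕ.<⇒≤ b<x)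

  -- Maps given by the two-row array: position relative to the diagonal, and crossings.

  -- Abstracts from `Φ`: `tops` and `nontops` are the two halves of the bottom row, and `τ` sends
  -- them, letter by letter, to the two increasing halves of the top row.
  record IsRearrangement (τ τ⁻¹ : ℕ → ℕ) : Set where
    field
      {tops nontops} : List ℕ
      tops-arr       : LargerToLeft (crossings ρ) DT tops
      nontops-arr    : SmallerToRight (crossings ρ) NT nontops
      inv            : ∀ {x} → 1 ≤ x → x ≤ M → τ⁻¹ (τ x) ≡ x
      tops-image     : map τ tops ≡ DB
      nontops-image  : map τ nontops ≡ NB

    private
      tops-! : Unique tops
      tops-! = SetoidPermP.Unique-resp-↭ (setoid ℕ) (↭⇒↭ₛ (↭-sym (arrangement tops-arr)))
        (Unique.filter⁺ (descentTop? ρ) (letters-! M))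

      nontops-! : Unique nontops
      nontops-! = SetoidPermP.Unique-resp-↭ (setoid ℕ) (↭⇒↭ₛ (↭-sym (arrangement nontops-arr)))
        (Unique.filter⁺ (¬? ∘ descentTop? ρ) (letters-! M))

      increasing-tops : AllPairs _<_ (map τ tops)
      increasing-tops = subst (AllPairs _<_) (sym tops-image) (sorted (descentBottom? ρ))

      increasing-nontops : AllPairs _<_ (map τ nontops)
      increasing-nontops = subst (AllPairs _<_) (sym nontops-image) (sorted (¬? ∘ descentBottom? ρ))

      ∈tops⁺ : ∀ {b} → b ∈ DT → b ∈ tops
      ∈tops⁺ = Perm↭.∈-resp-↭ (↭-sym (arrangement tops-arr))

      ∈tops⁻ : ∀ {b} → b ∈ tops → b ∈ DT
      ∈tops⁻ = Perm↭.∈-resp-↭ (arrangement tops-arr)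

      ∈nontops⁺ : ∀ {b} → b ∈ NT → b ∈ nontops
      ∈nontops⁺ = Perm↭.∈-resp-↭ (↭-sym (arrangement nontops-arr))

      ∈nontops⁻ : ∀ {b} → b ∈ nontops → b ∈ NT
      ∈nontops⁻ = Perm↭.∈-resp-↭ (arrangement nontops-arr)

      top-letter : ∀ {b} → b ∈ DT → b ∈ letters M
      top-letter b∈ = proj₁ (∈-filter⁻ (descentTop? ρ) b∈)

      nontop-letter : ∀ {b} → b ∈ NT → b ∈ letters M
      nontop-letter b∈ = proj₁ (∈-filter⁻ (¬? ∘ descentTop? ρ) b∈)

      top-or-not : ∀ {y} → y ∈ letters M → y ∈ DT ⊎ y ∈ NT
      top-or-not {y} y∈ = ∈-++⁻ DT
        (Perm↭.∈-resp-↭ (↭-sym (filter-++-filter (descentTop? ρ) (letters M))) y∈)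

    τ-<-top : ∀ {b} → b ∈ DT → τ b < b
    τ-<-top {b} b∈ = image-<-larger τ tops-arr tops-! increasing-tops (∈tops⁺ b∈)
      (subst (λ l → crossings ρ b + length (filter (_<? b) DT) < length (filter (_<? b) l))
        (sym tops-image) (tops-<-bottoms b∈))

    τ-≥-nontop : ∀ {b} → b ∈ NT → b ≤ τ b
    τ-≥-nontop {b} b∈ with 1≤b , b≤M ← ∈letters⁻ {M} (nontop-letter b∈) =
      image-≥-smaller τ nontops-arr nontops-! increasing-nontops (∈nontops⁺ b∈)
        (subst (λ l → crossings ρ b + length (filter (b <?_) NT) < length (filter (b ≤?_) l))
          (sym nontops-image) (nontops-<-nonbottoms 1≤b b≤M))

    -- The count over `tops` from `count-larger` extends to all letters: a nontop `y > b` satisfies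
    -- `τ y ≥ y > b > τ b`, so it contributes nothing.
    crossings-top : ∀ {b} → b ∈ DT →
      crossings ρ b ≡ count (λ y → b <? y ×-dec τ y <? τ b) M
    crossings-top {b} b∈ = trans
      (count-larger τ tops-arr tops-! increasing-tops (∈tops⁺ b∈))
      (ℕ.≤-antisym (length-⊆ (Unique.filter⁺ P? tops-!) to)
                   (length-⊆ (Unique.filter⁺ P? (letters-! M)) from))
      where
      P? = λ y → b <? y ×-dec τ y <? τ b
      to : ∀ {y} → y ∈ filter P? tops → y ∈ filter P? (letters M)
      to y∈ = let y∈tops , p = ∈-filter⁻ P? {xs = tops} y∈ in
        ∈-filter⁺ P? (top-letter (∈tops⁻ y∈tops)) p
      from : ∀ {y} → y ∈ filter P? (letters M) → y ∈ filter P? tops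
      from y∈ with y∈l , b<y , τy<τb ← ∈-filter⁻ P? {xs = letters M} y∈ with top-or-not y∈l
      ... | inj₁ y∈DT = ∈-filter⁺ P? (∈tops⁺ y∈DT) (b<y , τy<τb)
      ... | inj₂ y∈NT = contradiction (ℕ.≤-trans (τ-≥-nontop y∈NT) (ℕ.<⇒≤ τy<τb))
        (ℕ.<⇒≱ (ℕ.<-trans (τ-<-top b∈) b<y))

    -- Here a top `y < b` contributes nothing, as `τ y < y < b ≤ τ b`.
    crossings-nontop : ∀ {b} → b ∈ NT →
      crossings ρ b ≡ count (λ y → y <? b ×-dec τ b <? τ y) M
    crossings-nontop {b} b∈ = trans
      (count-smaller τ nontops-arr nontops-! increasing-nontops (∈nontops⁺ b∈))
      (ℕ.≤-antisym (length-⊆ (Unique.filter⁺ P? nontops-!) to)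
                   (length-⊆ (Unique.filter⁺ P? (letters-! M)) from))
      where
      P? = λ y → y <? b ×-dec τ b <? τ y
      to : ∀ {y} → y ∈ filter P? nontops → y ∈ filter P? (letters M)
      to y∈ = let y∈nontops , p = ∈-filter⁻ P? {xs = nontops} y∈ in
        ∈-filter⁺ P? (nontop-letter (∈nontops⁻ y∈nontops)) p
      from : ∀ {y} → y ∈ filter P? (letters M) → y ∈ filter P? nontops
      from y∈ with y∈l , y<b , τb<τy ← ∈-filter⁻ P? {xs = letters M} y∈ with top-or-not y∈l
      ... | inj₂ y∈NT = ∈-filter⁺ P? (∈nontops⁺ y∈NT) (y<b , τb<τy)
      ... | inj₁ y∈DT = contradiction (ℕ.≤-trans (τ-≥-nontop b∈) (ℕ.<⇒≤ τb<τy))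
        (ℕ.<⇒≱ (ℕ.<-trans (τ-<-top y∈DT) y<b))

    private
      -- Lets the inequalities for `τ` at bottom-row letters be read as inequalities for `τ⁻¹` at
      -- top-row letters.
      flip-preimage : ∀ {xs ys a} → map τ xs ≡ ys → a ∈ ys →
        (∀ {b} → b ∈ xs → b ∈ letters M) → τ⁻¹ a ∈ xs × τ (τ⁻¹ a) ≡ a
      flip-preimage {xs} refl a∈ sub =
        let b , b∈ , a≡ = ∈-map⁻ τ {xs = xs} a∈
            1≤b , b≤M = ∈letters⁻ {M} (sub b∈)
            eq = trans (cong τ⁻¹ a≡) (inv 1≤b b≤M)
        in subst (_∈ xs) (sym eq) b∈ , trans (cong τ eq) (sym a≡)

    τ⁻¹->-bottom : ∀ {a} → a ∈ DB → a < τ⁻¹ a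
    τ⁻¹->-bottom {a} a∈ =
      let b∈ , eq = flip-preimage tops-image a∈ (top-letter ∘ ∈tops⁻)
      in subst (_< τ⁻¹ a) eq (τ-<-top (∈tops⁻ b∈))

    τ⁻¹-≤-nonbottom : ∀ {a} → a ∈ NB → τ⁻¹ a ≤ a
    τ⁻¹-≤-nonbottom {a} a∈ =
      let b∈ , eq = flip-preimage nontops-image a∈ (nontop-letter ∘ ∈nontops⁻)
      in subst (τ⁻¹ a ≤_) eq (τ-≥-nontop (∈nontops⁻ b∈))

  private
    -- There are as many descent tops as descent bottoms, so both rows of the array are cut at the
    -- same column and the equation between whole rows splits into its two halves.
    Φ-words : map (Φ ρ ⟪_⟫) (f′ ρ) ≡ DB × map (Φ ρ ⟪_⟫) (g′ ρ) ≡ NB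
    Φ-words = ++-injective
      (trans (List.length-map (Φ ρ ⟪_⟫) (f′ ρ))
        (trans (Perm↭.↭-length (arrangement (f′-arranged ρ))) (sym length-bottoms)))
      (trans (sym (List.map-++ (Φ ρ ⟪_⟫) (f′ ρ) (g′ ρ)))
        (map≡⁺ (Φ ρ ⟪_⟫) (f ρ ++ g ρ) (f′ ρ ++ g′ ρ)
          (Perm↭.↭-length (↭-trans (top-↭ ρ) (↭-sym (bottom-↭ ρ)))) (Φ-column ρ)))

  Φ-isRearrangement : IsRearrangement (Φ ρ ⟪_⟫) (flip (Φ ρ) ⟪_⟫)
  Φ-isRearrangement = record
    { tops-arr      = f′-arranged ρ
    ; nontops-arr   = g′-arranged ρ
    ; inv           = flip-⟪⟫ (Φ ρ)
    ; tops-image    = proj₁ Φ-words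
    ; nontops-image = proj₂ Φ-words
    }

-- Nestings after removal of the first letter.

module _ (π : Permutation′ m) (τ : ℕ → ℕ)
  (shift : ∀ {i} → 1 ≤ i → i ≤ m → π ⟪ i ⟫ ≡ τ (suc i)) {i : ℕ} (1≤i : 1 ≤ i) (i≤m : i ≤ m) where

  private
    Nested : ℕ → Set
    Nested j = (j < i × i < π ⟪ i ⟫ × π ⟪ i ⟫ < π ⟪ j ⟫) ⊎ (π ⟪ j ⟫ < π ⟪ i ⟫ × π ⟪ i ⟫ ≤ i × i < j)

    nested? : Decidable Nested
    nested? j = (j <? i ×-dec i <? π ⟪ i ⟫ ×-dec π ⟪ i ⟫ <? π ⟪ j ⟫)
                ⊎-dec
                (π ⟪ j ⟫ <? π ⟪ i ⟫ ×-dec π ⟪ i ⟫ ≤? i ×-dec i <? j)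

    nested! : Unique (filter nested? (letters m))
    nested! = Unique.filter⁺ nested? (letters-! m)

  -- The hypothesis says `π ⟪ i ⟫ ≤ i`, which leaves only the second alternative of `nest`; shifting
  -- positions by one turns it into the condition on `τ`.
  nest-below : τ (suc i) < suc i →
    nest π i ≡ count (λ y → suc i <? y ×-dec τ y <? τ (suc i)) (suc m)
  nest-below τ< = pigeonhole-≡ suc pred nested! (Unique.filter⁺ P? (letters-! (suc m))) to from
    where
    P? = λ y → suc i <? y ×-dec τ y <? τ (suc i)
    πi≤i : π ⟪ i ⟫ ≤ i
    πi≤i = subst (_≤ i) (sym (shift 1≤i i≤m)) (ℕ.≤-pred τ<)
    to : ∀ {j} → j ∈ filter nested? (letters m) →
      suc j ∈ filter P? (letters (suc m)) × pred (suc j) ≡ j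
    to {j} j∈ with j∈l , nested ← ∈-filter⁻ nested? {xs = letters m} j∈
      with 1≤j , j≤m ← ∈letters⁻ {m} j∈l
      with nested
    ... | inj₁ (_ , i<πi , _) = contradiction πi≤i (ℕ.<⇒≱ i<πi)
    ... | inj₂ (lt , _ , i<j) = ∈-filter⁺ P? (∈letters⁺ (s≤s z≤n) (s≤s j≤m))
      (s≤s i<j , subst₂ _<_ (shift 1≤j j≤m) (shift 1≤i i≤m) lt) , refl
    from : ∀ {y} → y ∈ filter P? (letters (suc m)) →
      pred y ∈ filter nested? (letters m) × suc (pred y) ≡ y
    from {y} y∈ with y∈l , lt , τlt ← ∈-filter⁻ P? {xs = letters (suc m)} y∈
      with y | ∈letters⁻ {suc m} y∈l | lt
    ... | suc j | _ , s≤s j≤m | s≤s i<j = ∈-filter⁺ nested? (∈letters⁺ 1≤j j≤m)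
      (inj₂ (subst₂ _<_ (sym (shift 1≤j j≤m)) (sym (shift 1≤i i≤m)) τlt , πi≤i , i<j)) , refl
      where
      1≤j : 1 ≤ j
      1≤j = ℕ.≤-trans (s≤s z≤n) i<j

  -- The extra letter is 1, whose image is the largest.

  nest-above : τ 1 ≡ suc m → suc i ≤ τ (suc i) →
    suc (nest π i) ≡ count (λ y → y <? suc i ×-dec τ (suc i) <? τ y) (suc m)
  nest-above first τ≥ =
    -- The prepended `0` accounts for the `suc` on the left: shifting positions by one sends it to
    -- that extra letter.
    pigeonhole-≡ suc pred (∉⇒All≢ 0∉ ∷ nested!) (Unique.filter⁺ P? (letters-! (suc m))) to from
    where
    P? = λ y → y <? suc i ×-dec τ (suc i) <? τ y
    i<πi : i < π ⟪ i ⟫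
    i<πi = subst (i <_) (sym (shift 1≤i i≤m)) τ≥
    0∉ : 0 ∉ filter nested? (letters m)
    0∉ 0∈ with () ← proj₁ (∈letters⁻ {m} (proj₁ (∈-filter⁻ nested? {xs = letters m} 0∈)))
    to : ∀ {j} → j ∈ 0 ∷ filter nested? (letters m) →
      suc j ∈ filter P? (letters (suc m)) × pred (suc j) ≡ j
    to (here refl) = ∈-filter⁺ P? (∈letters⁺ (s≤s z≤n) (s≤s z≤n)) (s≤s 1≤i ,
      subst₂ _<_ (shift 1≤i i≤m) (sym first) (s≤s (⟪⟫-≤ π 1≤i i≤m))) , refl
    to {j} (there j∈) with j∈l , nested ← ∈-filter⁻ nested? {xs = letters m} j∈
      with 1≤j , j≤m ← ∈letters⁻ {m} j∈l
      with nested
    ... | inj₂ (_ , πi≤i , _) = contradiction πi≤i (ℕ.<⇒≱ i<πi)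
    ... | inj₁ (j<i , _ , lt) = ∈-filter⁺ P? (∈letters⁺ (s≤s z≤n) (s≤s j≤m))
      (s≤s j<i , subst₂ _<_ (shift 1≤i i≤m) (shift 1≤j j≤m) lt) , refl
    from : ∀ {y} → y ∈ filter P? (letters (suc m)) →
      pred y ∈ 0 ∷ filter nested? (letters m) × suc (pred y) ≡ y
    from {y} y∈ with y∈l , lt , τlt ← ∈-filter⁻ P? {xs = letters (suc m)} y∈
      with y | ∈letters⁻ {suc m} y∈l | lt
    ... | suc zero | _ | _ = here refl , refl
    ... | suc j@(suc _) | _ , s≤s j≤m | s≤s j<i = there (∈-filter⁺ nested? (∈letters⁺ (s≤s z≤n) j≤m)
      (inj₁ (j<i , i<πi , subst₂ _<_ (sym (shift 1≤i i≤m)) (sym (shift (s≤s z≤n) j≤m)) τlt))) , refl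

-- Evaluation of the two step functions.

module _ (π : Permutation′ m) (i : ℕ) where

  stepYZL-U : i < π ⟪ i ⟫ → suc i ≤ flip π ⟪ suc i ⟫ → stepYZL π i ≡ U
  stepYZL-U p q with i <? π ⟪ i ⟫ | suc i ≤? flip π ⟪ suc i ⟫
  ... | yes _ | yes _ = refl
  ... | no ¬p | _     = contradiction p ¬p
  ... | yes _ | no ¬q = contradiction q ¬q

  stepYZL-D : ¬ i < π ⟪ i ⟫ → ¬ suc i ≤ flip π ⟪ suc i ⟫ → stepYZL π i ≡ D
  stepYZL-D p q with i <? π ⟪ i ⟫ | suc i ≤? flip π ⟪ suc i ⟫
  ... | no _  | no _  = refl
  ... | yes ¬p | _    = contradiction ¬p p
  ... | no _ | yes ¬q = contradiction ¬q q

  stepYZL-L-b : i < π ⟪ i ⟫ → ¬ suc i ≤ flip π ⟪ suc i ⟫ → stepYZL π i ≡ L-b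
  stepYZL-L-b p q with i <? π ⟪ i ⟫ | suc i ≤? flip π ⟪ suc i ⟫
  ... | yes _ | no _  = refl
  ... | no ¬p | _     = contradiction p ¬p
  ... | yes _ | yes ¬q = contradiction ¬q q

  stepYZL-L-r : ¬ i < π ⟪ i ⟫ → suc i ≤ flip π ⟪ suc i ⟫ → stepYZL π i ≡ L-r
  stepYZL-L-r p q with i <? π ⟪ i ⟫ | suc i ≤? flip π ⟪ suc i ⟫
  ... | no _  | yes _ = refl
  ... | yes ¬p | _    = contradiction ¬p p
  ... | no _ | no ¬q = contradiction q ¬q

module _ (σ : Permutation′ m) (x : ℕ) where

  private
    choose : Bool → Bool → Bool → Step
    choose v p a = if v then U else if p then D else if a then L-b else L-r

  stepFV-U : Valley σ x → stepFV σ x ≡ U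
  stepFV-U v = cong (λ b → choose b (does (peak? σ x)) (does (doubleAscent? σ x))) (dec-true (valley? σ x) v)

  stepFV-D : Peak σ x → stepFV σ x ≡ D
  stepFV-D p@(a , _) = cong₂ (λ b c → choose b c (does (doubleAscent? σ x)))
    (dec-false (valley? σ x) λ (b , _) → ℕ.<-asym a b) (dec-true (peak? σ x) p)

  stepFV-L-b : DoubleAscent σ x → stepFV σ x ≡ L-b
  stepFV-L-b p@(a , b) = trans
    (cong₂ (λ u v → choose u v (does (doubleAscent? σ x)))
      (dec-false (valley? σ x) λ (c , _) → ℕ.<-asym a c)
      (dec-false (peak? σ x) λ (_ , c) → ℕ.<-asym b c))
    (cong (λ w → choose false false w) (dec-true (doubleAscent? σ x) p))

  stepFV-L-r : DoubleDescent σ x → stepFV σ x ≡ L-r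
  stepFV-L-r (a , b) = trans
    (cong₂ (λ u v → choose u v (does (doubleAscent? σ x)))
      (dec-false (valley? σ x) λ (_ , c) → ℕ.<-asym b c)
      (dec-false (peak? σ x) λ (c , _) → ℕ.<-asym a c))
    (cong (λ w → choose false false w) (dec-false (doubleAscent? σ x) λ (c , _) → ℕ.<-asym a c))

-- Crossings of a level by a sequence.

count-accept : {P : Pred ℕ 0ℓ} (P? : Decidable P) (k : ℕ) → P (suc k) → count P? (suc k) ≡ suc (count P? k)
count-accept P? k p with count-suc P? k
... | inj₁ (_ , e) = e
... | inj₂ (¬p , _) = contradiction p ¬p

count-reject : {P : Pred ℕ 0ℓ} (P? : Decidable P) (k : ℕ) → ¬ P (suc k) → count P? (suc k) ≡ count P? k
count-reject P? k ¬p with count-suc P? k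
... | inj₁ (p , _) = contradiction p ¬p
... | inj₂ (_ , e) = e

count-none : {P : Pred ℕ 0ℓ} (P? : Decidable P) (k : ℕ) → (∀ {j} → j ≤ k → ¬ P j) → count P? k ≡ 0
count-none P? zero _ = refl
count-none P? (suc k) none = trans (count-reject P? k (none ℕ.≤-refl))
  (count-none P? k (none ∘ ℕ.m≤n⇒m≤1+n))

-- Indicator of the side of the level `b`. It changes by one at each crossing, so the difference of
-- the numbers of down and up crossings telescopes to a difference of two of its values.
above : ℕ → ℕ → ℕ
above b x = if does (b <? x) then 1 else 0

above-yes : ∀ {b x} → b < x → above b x ≡ 1
above-yes {b} {x} b<x = cong (λ t → if t then 1 else 0) (dec-true (b <? x) b<x)

above-no : ∀ {b x} → x < b → above b x ≡ 0
above-no {b} {x} x<b = cong (λ t → if t then 1 else 0) (dec-false (b <? x) (ℕ.<-asym x<b))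

-- Steps of the sequence a down and up across the level b alternate.

module _ (a : ℕ → ℕ) (b p M : ℕ) (apart : ∀ {j} → p < j → j ≤ M → b ≢ a j) where

  private
    down? = λ j → p <? j ×-dec j <? M ×-dec a (suc j) <? b ×-dec b <? a j
    up?   = λ j → p <? j ×-dec j <? M ×-dec a j <? b ×-dec b <? a (suc j)

  down-up : ∀ d → p + d < M →
    count down? (p + d) + above b (a (suc (p + d))) ≡ count up? (p + d) + above b (a (suc p))
  down-up zero _ rewrite ℕ.+-identityʳ p = cong (_+ above b (a (suc p)))
    (trans (count-none down? p λ j≤p (p<j , _) → ℕ.<⇒≱ p<j j≤p)
           (sym (count-none up? p λ j≤p (p<j , _) → ℕ.<⇒≱ p<j j≤p)))
  down-up (suc d) k<M rewrite ℕ.+-suc p d = step (p + d) (s≤s (ℕ.m≤m+n p d)) k<M (down-up d (ℕ.<⇒≤ k<M))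
    where
    step : ∀ k → p < suc k → suc k < M →
      count down? k + above b (a (suc k)) ≡ count up? k + above b (a (suc p)) →
      count down? (suc k) + above b (a (suc (suc k))) ≡ count up? (suc k) + above b (a (suc p))
    step k p<k k<M ih with ℕ.<-cmp b (a (suc k)) | ℕ.<-cmp b (a (suc (suc k)))
    ... | tri≈ _ e _ | _ = contradiction e (apart p<k (ℕ.<⇒≤ k<M))
    ... | _ | tri≈ _ e _ = contradiction e (apart (ℕ.m≤n⇒m≤1+n p<k) k<M)
    ... | tri< x _ _ | tri< y _ _
      rewrite count-reject down? k (λ (_ , _ , lo , _) → ℕ.<-asym lo y)
            | count-reject up? k (λ (_ , _ , lo , _) → ℕ.<-asym lo x)
            | above-yes x | above-yes y = ih
    ... | tri> _ _ x | tri> _ _ y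
      rewrite count-reject down? k (λ (_ , _ , _ , hi) → ℕ.<-asym hi x)
            | count-reject up? k (λ (_ , _ , _ , hi) → ℕ.<-asym hi y)
            | above-no x | above-no y = ih
    ... | tri< x _ _ | tri> _ _ y
      rewrite count-accept down? k (p<k , k<M , y , x)
            | count-reject up? k (λ (_ , _ , lo , _) → ℕ.<-asym lo x)
            | above-yes x | above-no y = trans (sym (ℕ.+-suc (count down? k) 0)) ih
    ... | tri> _ _ x | tri< y _ _
      rewrite count-reject down? k (λ (_ , _ , _ , hi) → ℕ.<-asym hi x)
            | count-accept up? k (p<k , k<M , x , y)
            | above-no x | above-yes y = trans (ℕ.+-suc (count down? k) 0) (cong suc ih)

-- Comparison of the statistics of `σ` at `i` with those of the extended word at `i + 1`.

module _ (σ : Permutation′ m) {i : ℕ} (1≤i : 1 ≤ i) (i<m : i < m) where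

  private
    M b p : ℕ
    M = suc m
    b = suc i
    p = flip σ ⟪ i ⟫

    1≤p : 1 ≤ p
    1≤p = ⟪⟫-pos (flip σ) 1≤i (ℕ.<⇒≤ i<m)

    p≤m : p ≤ m
    p≤m = ⟪⟫-≤ (flip σ) 1≤i (ℕ.<⇒≤ i<m)

    σp : σ ⟪ p ⟫ ≡ i
    σp = ⟪⟫-flip σ 1≤i (ℕ.<⇒≤ i<m)

    -- Valid at the last position `M` too: the convention gives `σ ⟪ M ⟫` the value 0, and the
    -- extended word ends with 1.
    hat : ∀ {j} → 1 ≤ j → j ≤ M → σ ^ ⟪ j ⟫ ≡ suc (σ ⟪ j ⟫)
    hat 1≤j j≤M with ℕ.m≤n⇒m<n∨m≡n j≤M
    ... | inj₁ (s≤s j≤m) = ^-⟪⟫ σ 1≤j j≤m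
    ... | inj₂ refl = trans (^-last σ) (cong suc (sym (⟪⟫-beyond σ)))

    hat-next : σ ^ ⟪ suc p ⟫ ≡ suc (σ ⟪ suc p ⟫)
    hat-next = hat (s≤s z≤n) (s≤s p≤m)

    hat-p : σ ^ ⟪ p ⟫ ≡ b
    hat-p = trans (hat 1≤p (ℕ.m≤n⇒m≤1+n p≤m)) (cong suc σp)

    hat-pos : flip (σ ^) ⟪ b ⟫ ≡ p
    hat-pos = trans (cong (flip (σ ^) ⟪_⟫) (sym hat-p)) (flip-⟪⟫ (σ ^) 1≤p (ℕ.m≤n⇒m≤1+n p≤m))

    b∈ : b ∈ letters M
    b∈ = ∈letters⁺ (s≤s z≤n) (ℕ.m≤n⇒m≤1+n i<m)

    Falls Falls′ : ℕ → Set
    Falls q = q < M × σ ^ ⟪ q ⟫ > σ ^ ⟪ suc q ⟫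
    Falls′ q = 2 ≤ q × σ ^ ⟪ q ∸ 1 ⟫ > σ ^ ⟪ q ⟫

  -- If `i` is the last letter of `σ`, the conventional 0 after it corresponds to the final 1 of the
  -- extended word, so this case also yields a descent.
  top : σ ⟪ suc p ⟫ < i → b ∈ descentTops (σ ^)
  top lt = ∈-filter⁺ (descentTop? (σ ^)) b∈ (subst Falls (sym hat-pos)
    (s≤s p≤m , subst₂ _<_ (sym hat-next) (sym hat-p) (s≤s lt)))

  nontop : i < σ ⟪ suc p ⟫ → b ∈ nondescentTops (σ ^)
  nontop lt = ∈-filter⁺ (¬? ∘ descentTop? (σ ^)) b∈ λ d →
    ℕ.<-asym lt (ℕ.≤-pred (subst₂ _<_ hat-next hat-p (proj₂ (subst Falls hat-pos d))))

  bottom : i < σ ⟪ p ∸ 1 ⟫ → b ∈ descentBottoms (σ ^)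
  bottom lt = ∈-filter⁺ (descentBottom? (σ ^)) b∈ (subst Falls′ (sym hat-pos) (falls p 1≤p p≤m hat-p lt))
    where
    falls : ∀ q → 1 ≤ q → q ≤ m → σ ^ ⟪ q ⟫ ≡ b → i < σ ⟪ q ∸ 1 ⟫ → Falls′ q
    -- Position 1 cannot occur: the value before it is 0 by convention, hence not above `i`.
    falls (suc (suc q)) _ q≤m e lt = s≤s (s≤s z≤n) ,
      subst₂ _<_ (sym e) (sym (hat (s≤s z≤n) (ℕ.m≤n⇒m≤1+n (ℕ.<⇒≤ q≤m)))) (s≤s lt)

  nonbottom : σ ⟪ p ∸ 1 ⟫ < i → b ∈ nondescentBottoms (σ ^)
  nonbottom lt = ∈-filter⁺ (¬? ∘ descentBottom? (σ ^)) b∈ λ d →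
    rises p p≤m hat-p lt (subst Falls′ hat-pos d)
    where
    rises : ∀ q → q ≤ m → σ ^ ⟪ q ⟫ ≡ b → σ ⟪ q ∸ 1 ⟫ < i → ¬ Falls′ q
    rises (suc (suc q)) q≤m e lt (_ , gt) = ℕ.<-asym lt
      (ℕ.≤-pred (subst₂ _<_ e (hat (s≤s z≤n) (ℕ.m≤n⇒m≤1+n (ℕ.<⇒≤ q≤m))) gt))
    rises (suc zero) _ _ _ (s≤s () , _)

  -- After the letter `b`, down and up crossings alternate and the word ends below `b`. Hence there
  -- is one more down crossing than up crossings if the letter right after `b` is above `b`, and
  -- equally many otherwise.
  crossings-weightFV : crossings (σ ^) b ≡ weightFV σ i + above i (σ ⟪ suc p ⟫)
  crossings-weightFV = begin
    count down? M                                     ≡⟨ count-reject down? m (λ (_ , M<M , _) → ℕ.<-irrefl refl M<M) ⟩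
    count down? m                                     ≡⟨ ℕ.+-identityʳ _ ⟨
    count down? m + 0                                 ≡⟨ cong (count down? m +_) (above-no below) ⟨
    count down? m + above b (σ ^ ⟪ M ⟫)               ≡⟨ alternate ⟩
    count up? m + above b (σ ^ ⟪ suc q ⟫)             ≡⟨ cong (λ x → count up? m + above b x) (trans (cong (λ j → σ ^ ⟪ suc j ⟫) hat-pos) hat-next) ⟩
    count up? m + above i (σ ⟪ suc p ⟫)               ≡⟨ cong (_+ above i (σ ⟪ suc p ⟫)) up≡ ⟩
    weightFV σ i + above i (σ ⟪ suc p ⟫)              ∎
    where
    open ≡-Reasoning
    q : ℕ
    q = flip (σ ^) ⟪ b ⟫
    down? = λ j → q <? j ×-dec j <? M ×-dec σ ^ ⟪ suc j ⟫ <? b ×-dec b <? σ ^ ⟪ j ⟫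
    up?   = λ j → q <? j ×-dec j <? M ×-dec σ ^ ⟪ j ⟫ <? b ×-dec b <? σ ^ ⟪ suc j ⟫
    weight? = λ j → p <? j ×-dec j <? m ×-dec σ ⟪ j ⟫ <? i ×-dec i <? σ ⟪ suc j ⟫
    below : σ ^ ⟪ M ⟫ < b
    below = subst (_< b) (sym (^-last σ)) (s≤s 1≤i)
    q≤m : q ≤ m
    q≤m = subst (_≤ m) (sym hat-pos) p≤m
    apart : ∀ {j} → q < j → j ≤ M → b ≢ σ ^ ⟪ j ⟫
    apart q<j j≤M e = ℕ.<⇒≢ q<j
      (trans (cong (flip (σ ^) ⟪_⟫) e) (flip-⟪⟫ (σ ^) (ℕ.≤-trans (s≤s z≤n) q<j) j≤M))
    alternate : count down? m + above b (σ ^ ⟪ M ⟫) ≡ count up? m + above b (σ ^ ⟪ suc q ⟫)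
    alternate = subst
      (λ k → count down? k + above b (σ ^ ⟪ suc k ⟫) ≡ count up? k + above b (σ ^ ⟪ suc q ⟫))
      (ℕ.m+[n∸m]≡n q≤m)
      (down-up (σ ^ ⟪_⟫) b q M apart (m ∸ q) (s≤s (ℕ.≤-reflexive (ℕ.m+[n∸m]≡n q≤m))))
    to : ∀ {j} → j ∈ filter up? (letters m) → j ∈ filter weight? (letters m)
    to {j} j∈ with j∈l , q<j , j<M , lo , hi ← ∈-filter⁻ up? {xs = letters m} j∈
      with 1≤j , j≤m ← ∈letters⁻ {m} j∈l
      with ℕ.m≤n⇒m<n∨m≡n j≤m
    -- The step from position `m` leads to the final 1, which is below `b`. So it is no up crossing,
    -- and the range `j < M` agrees with the range `j < m` of `weightFV`.
    ... | inj₂ refl = contradiction hi (ℕ.<-asym below)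
    ... | inj₁ j<m = ∈-filter⁺ weight? j∈l
      ( subst (_< j) hat-pos q<j , j<m
      , ℕ.≤-pred (subst (_< b) (hat 1≤j (ℕ.<⇒≤ j<M)) lo)
      , ℕ.≤-pred (subst (b <_) (hat (s≤s z≤n) j<M) hi))
    from : ∀ {j} → j ∈ filter weight? (letters m) → j ∈ filter up? (letters m)
    from {j} j∈ with j∈l , p<j , j<m , lo , hi ← ∈-filter⁻ weight? {xs = letters m} j∈
      with 1≤j , j≤m ← ∈letters⁻ {m} j∈l = ∈-filter⁺ up? j∈l
      ( subst (_< j) (sym hat-pos) p<j , s≤s j≤m
      , subst (_< b) (sym (hat 1≤j (ℕ.m≤n⇒m≤1+n j≤m))) (s≤s lo)
      , subst (b <_) (sym (hat (s≤s z≤n) (s≤s j≤m))) (s≤s hi))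
    up≡ : count up? m ≡ weightFV σ i
    up≡ = ℕ.≤-antisym (length-⊆ (Unique.filter⁺ up? (letters-! m)) to)
                      (length-⊆ (Unique.filter⁺ weight? (letters-! m)) from)

  module _ (π : Permutation′ m) {τ τ⁻¹ : ℕ → ℕ} (R : IsRearrangement (σ ^) τ τ⁻¹)
    (shift : ∀ {j} → 1 ≤ j → j ≤ m → π ⟪ j ⟫ ≡ τ (suc j)) (first : τ 1 ≡ suc m) where

    private
      open module R = IsRearrangement R

      πi : π ⟪ i ⟫ ≡ τ b
      πi = shift 1≤i (ℕ.<⇒≤ i<m)

      -- The `suc` is the shift of positions caused by removing the first letter of `τ`.
      π⁻¹b : suc (flip π ⟪ b ⟫) ≡ τ⁻¹ b
      π⁻¹b = trans (sym (inv (s≤s z≤n) (s≤s y≤m)))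
        (cong τ⁻¹ (trans (sym (shift 1≤y y≤m)) (⟪⟫-flip π (s≤s z≤n) i<m)))
        where
        1≤y = ⟪⟫-pos (flip π) (s≤s z≤n) i<m
        y≤m = ⟪⟫-≤ (flip π) (s≤s z≤n) i<m

      rises : i < σ ⟪ suc p ⟫ → i < π ⟪ i ⟫
      rises lt = subst (i <_) (sym πi) (τ-≥-nontop (nontop lt))

      falls : σ ⟪ suc p ⟫ < i → ¬ i < π ⟪ i ⟫
      falls lt i< = ℕ.<⇒≱ (τ-<-top (top lt)) (subst (i <_) πi i<)

      rises⁻¹ : i < σ ⟪ p ∸ 1 ⟫ → b ≤ flip π ⟪ b ⟫
      rises⁻¹ lt = ℕ.≤-pred (subst (b <_) (sym π⁻¹b) (τ⁻¹->-bottom (bottom lt)))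

      falls⁻¹ : σ ⟪ p ∸ 1 ⟫ < i → ¬ b ≤ flip π ⟪ b ⟫
      falls⁻¹ lt b≤ = ℕ.<⇒≱ (s≤s b≤) (subst (_≤ b) (sym π⁻¹b) (τ⁻¹-≤-nonbottom (nonbottom lt)))

    -- The letter after `i` in `σ` decides whether `b` is a descent top, hence whether
    -- `i < π ⟪ i ⟫`; the letter before `i` decides whether `b` is a descent bottom, hence how `b`
    -- compares with its position in `π`. The four combinations are the four kinds of step.
    step-preserved : stepFV σ i ≡ stepYZL π i
    step-preserved with kinds-exhaustive σ 1≤i (ℕ.<⇒≤ i<m)
    ... | inj₁ v@(a , c) = trans (stepFV-U σ i v)
      (sym (stepYZL-U π i (rises (subst (_< σ ⟪ suc p ⟫) σp c)) (rises⁻¹ (subst (_< σ ⟪ p ∸ 1 ⟫) σp a))))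
    ... | inj₂ (inj₁ v@(a , c)) = trans (stepFV-D σ i v)
      (sym (stepYZL-D π i (falls (subst (σ ⟪ suc p ⟫ <_) σp c)) (falls⁻¹ (subst (σ ⟪ p ∸ 1 ⟫ <_) σp a))))
    ... | inj₂ (inj₂ (inj₁ v@(a , c))) = trans (stepFV-L-b σ i v)
      (sym (stepYZL-L-b π i (rises (subst (_< σ ⟪ suc p ⟫) σp c)) (falls⁻¹ (subst (σ ⟪ p ∸ 1 ⟫ <_) σp a))))
    ... | inj₂ (inj₂ (inj₂ v@(a , c))) = trans (stepFV-L-r σ i v)
      (sym (stepYZL-L-r π i (falls (subst (σ ⟪ suc p ⟫ <_) σp c)) (rises⁻¹ (subst (_< σ ⟪ p ∸ 1 ⟫) σp a))))

    -- If a larger letter follows `i`, the surplus down crossing in `crossings-weightFV` cancels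
    -- against the removed first letter in `nest-above`. If a smaller one follows, neither
    -- correction is present.
    weight-preserved : weightFV σ i ≡ nest π i
    weight-preserved with ℕ.<-cmp i (σ ⟪ suc p ⟫)
    ... | tri≈ _ e _ = contradiction (trans σp e) (⟪⟫-step-≢ σ p≤m (ℕ.≤-trans (s≤s z≤n) i<m))
    ... | tri< lt _ _ = ℕ.suc-injective (begin
      suc (weightFV σ i)                            ≡⟨ ℕ.+-comm 1 _ ⟩
      weightFV σ i + 1                              ≡⟨ cong (weightFV σ i +_) (above-yes lt) ⟨
      weightFV σ i + above i (σ ⟪ suc p ⟫)          ≡⟨ crossings-weightFV ⟨
      crossings (σ ^) b                             ≡⟨ crossings-nontop (nontop lt) ⟩
      _                                             ≡⟨ nest-above π τ shift 1≤i (ℕ.<⇒≤ i<m)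
                                                         first (τ-≥-nontop (nontop lt)) ⟨
      suc (nest π i)                            ∎)
      where open ≡-Reasoning
    ... | tri> _ _ gt = begin
      weightFV σ i                                  ≡⟨ ℕ.+-identityʳ _ ⟨
      weightFV σ i + 0                              ≡⟨ cong (weightFV σ i +_) (above-no gt) ⟨
      weightFV σ i + above i (σ ⟪ suc p ⟫)          ≡⟨ crossings-weightFV ⟨
      crossings (σ ^) b                             ≡⟨ crossings-top (top gt) ⟩
      _                                             ≡⟨ nest-below π τ shift 1≤i (ℕ.<⇒≤ i<m)
                                                         (τ-<-top (top gt)) ⟨
      nest π i                                  ∎
      where open ≡-Reasoning

theorem2p5 : ∀ (n : ℕ) → 1 ≤ n → (σ : Permutation′ (suc n)) → ψFV σ ≡ ψYZL (Ψ σ)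
theorem2p5 n _ σ = cong₂ _,_
  (tabulate-cong λ k → step-preserved σ (s≤s z≤n) (s≤s (Fin.toℕ<n k)) (Ψ σ) R (Ψ-⟪⟫ σ) (Φ^-first σ))
  (tabulate-cong λ k → weight-preserved σ (s≤s z≤n) (s≤s (Fin.toℕ<n k)) (Ψ σ) R (Ψ-⟪⟫ σ) (Φ^-first σ))
  where R = Φ-isRearrangement (σ ^)
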